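{- For every $J\subseteq[n-2]$, \[\sum_{\pi\in C_nD_{n-1,J}^{ -1}}\mathbf x^{\operatorname{cDes}(\pi)}t^{\pi^{ -1}(n)}=\sum_{\pi\in D_{n-1,J}^{ -1}C_n}\mathbf x^{\operatorname{cDes}(\pi)}t^{\pi^{ -1}(n)}.\]
   Context: $D_{n-1,J}=\{\pi\in\mathfrak S_{n-1}:\operatorname{Des}(\pi)=J\}$ where $\operatorname{Des}(\pi)=\{i:\pi(i)>\pi(i+1)\}$, and $D_{n-1,J}^{ -1}=\{\pi^{ -1}:\pi\in D_{n-1,J}\}$; $\mathfrak S_{n-1}$ is identified with the permutations in $\mathfrak S_n$ fixing $n$. Permutations are multiplied as functions, $(\sigma\tau)(i)=\sigma(\tau(i))$; $c_n=(1,2,\dots,n)=23\cdots n1$, $C_n=\langle c_n\rangle$, and for sets $XY=\{xy:x\in X,y\in Y\}$. For $\pi\in\mathfrak S_n$, $\operatorname{cDes}(\pi)=\{i\in[n]:\pi(i)>\pi(i+1)\}$ with $\pi(n+1):=\pi(1)$, and $\mathbf x^S=\prod_{i\in S}x_i$; $t$ is an additional variable. -}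

module Defs where

open import Data.Nat using (ℕ; zero; suc)
open import Data.Bool using (Bool; true; false; if_then_else_)
open import Data.Fin using (Fin; zero; suc; fromℕ; inject₁; toℕ)
open import Data.Fin.Properties using (_≟_; _<?_; any?; all?)
open import Data.Fin.Subset using (Subset)
open import Data.Vec using (Vec; []; _∷_; lookup; tabulate)
open import Data.Vec.Properties using (≡-dec)
import Data.Bool.Properties as BoolP
open import Data.List using (List; []; _∷_; map; concatMap; filter; foldr; allFin; upTo)
open import Data.List.Relation.Unary.Any using (Any)
import Data.List.Relation.Unary.Any as Any
open import Data.Product using (_,_; _×_)
open import Relation.Binary.PropositionalEquality using (_≡_)
open import Relation.Nullary using (Dec; yes; no; does)
open import Relation.Nullary.Decidable using (_→-dec_; _×-dec_)
open import Algebra.Bundles using (CommutativeSemiring)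
import Algebra.Definitions.RawSemiring as RS
open import Level using (Level)

-- Permutations of [n] in one-line notation: element i : Fin n stands for i+1,
-- and a vector π : Vec (Fin n) n stands for the map  i ↦ lookup π i .
Word : ℕ → Set
Word n = Vec (Fin n) n

allVecs : ∀ {n} (k : ℕ) → List (Vec (Fin n) k)
allVecs {n} zero    = [] ∷ []
allVecs {n} (suc k) = concatMap (λ v → map (λ a → a ∷ v) (allFin n)) (allVecs k)

IsPerm : ∀ {n} → Word n → Set
IsPerm {n} π = ∀ (i j : Fin n) → lookup π i ≡ lookup π j → i ≡ j

isPerm? : ∀ {n} (π : Word n) → Dec (IsPerm π)
isPerm? π = all? (λ i → all? (λ j → (lookup π i ≟ lookup π j) →-dec (i ≟ j)))

-- the symmetric group 𝔖_n as a duplicate-free list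
Sym : (n : ℕ) → List (Word n)
Sym n = filter isPerm? (allVecs n)

_∘ₚ_ : ∀ {n} → Word n → Word n → Word n
σ ∘ₚ τ = tabulate (λ i → lookup σ (lookup τ i))

-- inverse: π⁻¹(j) = the i with π(i) = j  (correct on permutations)
inv : ∀ {n} → Word n → Word n
inv π = tabulate (λ j → pick j (any? (λ i → lookup π i ≟ j)))
  where
  pick : ∀ {n} {P : Fin n → Set} → Fin n → Dec (Data.Product.∃ P) → Fin n
  pick j (yes (i , _)) = i
  pick j (no _)        = j

-- cyclic successor on Fin (suc k):  i ↦ i+1, last ↦ first  (i.e. i ↦ c_n(i))
next : ∀ {k} → Fin (suc k) → Fin (suc k)
next {zero}  zero    = zero
next {suc k} zero    = suc zero
next {suc k} (suc i) with next {k} i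
... | zero  = zero
... | suc j = suc (suc j)

cyc : ∀ {k} → Word (suc k)
cyc = tabulate next

idW : ∀ {n} → Word n
idW = tabulate (λ i → i)

cycPow : ∀ {k} → ℕ → Word (suc k)
cycPow zero    = idW
cycPow (suc r) = cyc ∘ₚ cycPow r

Cyc : (k : ℕ) → List (Word (suc k))
Cyc k = map cycPow (upTo (suc k))

-- descent set of σ ∈ 𝔖_{n-1} ⊆ 𝔖_n (n = m+2), as a subset of [n-2] = [m]:
-- coordinate i : Fin m stands for position i+1, and i+1 ∈ Des σ iff σ(i+1) > σ(i+2)
Des : ∀ {m} → Word (suc (suc m)) → Subset m
Des σ = tabulate (λ i → does (lookup σ (inject₁ (suc i)) <? lookup σ (inject₁ (inject₁ i))))

InD : ∀ {m} → Subset m → Word (suc (suc m)) → Set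
InD {m} J σ = (lookup σ (fromℕ (suc m)) ≡ fromℕ (suc m)) × (Des σ ≡ J)

inD? : ∀ {m} (J : Subset m) (σ : Word (suc (suc m))) → Dec (InD J σ)
inD? {m} J σ = (lookup σ (fromℕ (suc m)) ≟ fromℕ (suc m)) ×-dec ≡-dec BoolP._≟_ (Des σ) J

D : ∀ {m} → Subset m → List (Word (suc (suc m)))
D J = filter (inD? J) (Sym _)

Dinv : ∀ {m} → Subset m → List (Word (suc (suc m)))
Dinv J = map inv (D J)

InProd : ∀ {n} → List (Word n) → List (Word n) → Word n → Set
InProd X Y π = Any (λ x → Any (λ y → π ≡ x ∘ₚ y) Y) X

inProd? : ∀ {n} (X Y : List (Word n)) (π : Word n) → Dec (InProd X Y π)
inProd? X Y π = Any.any? (λ x → Any.any? (λ y → ≡-dec _≟_ π (x ∘ₚ y)) Y) X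

-- the product set XY, listed as a sublist of 𝔖_n (hence without repetitions)
Prod : ∀ {n} → List (Word n) → List (Word n) → List (Word n)
Prod {n} X Y = filter (inProd? X Y) (Sym n)

module Weights {c ℓ : Level} (R : CommutativeSemiring c ℓ) where
  open CommutativeSemiring R
  open RS rawSemiring using (_^_)

  xcDes : ∀ {k} → (Fin (suc k) → Carrier) → Word (suc k) → Carrier
  xcDes x π = foldr (λ i acc →
      (if does (lookup π (next i) <? lookup π i) then x i else 1#) * acc)
    1# (allFin _)

  -- x^{cDes(π)} t^{π^{-1}(n)}   (π^{-1}(n) taken as an integer in [n])
  weight : ∀ {k} → (Fin (suc k) → Carrier) → Carrier → Word (suc k) → Carrier
  weight {k} x t π = xcDes x π * (t ^ suc (toℕ (lookup (inv π) (fromℕ k))))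

  sumOver : ∀ {n} → List (Word n) → (Word n → Carrier) → Carrier
  sumOver S f = foldr (λ π acc → f π + acc) 0# S

{-# OPTIONS --safe #-}

-- Both products consist of one rotation for each pair (p , σ), where σ fixes n, Des(σ⁻¹) = J and
-- p is the final position of n: the values of σ are rotated on the left side, the positions on the
-- right side.  Hence the claim is that σ ↦ Des(shift p σ) and σ ↦ Des(σ) are equidistributed over
-- Des(σ⁻¹) = J, where shift p rotates values and positions so that the entry at p becomes a final n.
-- By Möbius inversion it is enough to count σ with Des(σ⁻¹) ⊆ J and descents contained in I.
-- Replacing each value by the number of its J-block turns such σ into words with fixed content.
-- Without the shift the condition says that the word increases within the I-blocks of positions.
-- With the shift, and with x the letter at p moved to the position q of the rotated n, it says
-- that the blocks left and right of q increase in an order of the letters rotated to start at x,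
-- while the block of q has letters ≥ x before q and letters ≤ x after q.  Sorting the block of q
-- decreasingly exhibits x; then all blocks can be re-sorted for the rotated order.  Both steps are
-- invertible, because a word is determined by the contents of its blocks once they are sorted.
module Submission where

open import Defs
open import Data.Nat using (ℕ; zero; suc; _+_; _≤_; _<_; _≤?_; z≤n; s≤s)
import Data.Nat.Properties as ℕₚ
open import Data.Nat.Tactic.RingSolver using (solve-∀)
open import Data.Bool using (Bool; true; false; if_then_else_; _∨_)
import Data.Bool.Properties as BoolP
open import Data.Fin as F using (Fin; zero; suc; inject₁; fromℕ; toℕ; opposite; punchOut)
import Data.Fin.Properties as Fₚ
open import Data.Fin.Induction using (<-wellFounded)
open import Data.Fin.Permutation.Components using (transpose; transpose-inverse)
open import Data.Fin.Relation.Unary.Top using (view; ‵fromℕ; ‵inj₁)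
open import Data.Fin.Subset using (Subset)
open import Data.List using (List; []; _∷_; _++_; map; filter; length; foldr; concatMap; cartesianProductWith; cartesianProduct; allFin)
open import Data.List.Properties using (map-cong-local)
open import Data.List.Membership.Propositional using (_∈_; find; lose)
open import Data.List.Membership.Propositional.Properties
import Data.List.Membership.Propositional.Properties.WithK as Memₖ
open import Data.List.Relation.Binary.BagAndSetEquality using (∼bag⇒↭)
open import Data.List.Relation.Binary.Permutation.Propositional as Perm using (_↭_; ↭-refl; ↭-sym; ↭-trans; ↭-reflexive; prep)
import Data.List.Relation.Binary.Permutation.Propositional.Properties as Permₚ
open import Data.List.Relation.Unary.All as All using ([]; _∷_)
import Data.List.Relation.Unary.All.Properties as Allₚ
open import Data.List.Relation.Unary.AllPairs using ([]; _∷_)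
open import Data.List.Relation.Unary.Any using (Any; here; there)
open import Data.List.Relation.Unary.Unique.Propositional using (Unique)
import Data.List.Relation.Unary.Unique.Propositional.Properties as Uniqueₚ
open import Data.Product using (∃; _×_; _,_; proj₁; proj₂; uncurry)
open import Data.Sum using (inj₁; inj₂)
open import Data.Vec using (Vec; []; _∷_; lookup; tabulate)
import Data.Vec.Properties as Vecₚ
open import Data.Vec.Properties using (lookup∘tabulate; tabulate∘lookup; tabulate-cong)
open import Algebra.Bundles using (CommutativeSemiring)
open import Algebra.Properties.CommutativeSemigroup ℕₚ.+-commutativeSemigroup using () renaming (interchange to +-interchange)
open import Function using (_∘_; _∋_; _⇔_; mk⇔; Equivalence)
open import Function.Definitions using (Injective)
open import Induction.WellFounded using (Acc; acc)
open import Level using (Level)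
open import Relation.Binary.Construct.Closure.ReflexiveTransitive using (Star; ε; _◅_; _◅◅_; gmap)
import Relation.Binary.Construct.Closure.ReflexiveTransitive as Star
open import Relation.Binary.Definitions using (DecidableEquality; tri<; tri≈; tri>)
open import Relation.Binary.PropositionalEquality hiding (setoid)
open import Relation.Nullary using (¬_; Dec; yes; no; does; contradiction)
open import Relation.Nullary.Decidable using (_→-dec_; dec-true; dec-false; does-⇔)
open import Relation.Unary using (Decidable)

-- Sorting the blocks of a word

-- The value rotation in `shift p σ` depends on the value of σ at p, while the word knows only its
-- J-block x. The reduction works because the values of one block stand in increasing order: entries
-- of block x to the right of p exceed σ(p), those to the left are below it. After the rotation of
-- positions these are the sides before and after q, so the position of a letter x decides where the
-- rotated order must place it. A second obstacle is circular: the order used for sorting depends on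
-- x, and x is read off the sorted word. The condition on the block of q breaks the circle. With
-- letters ≥ x before q and ≤ x after it, x is the letter that the weakly decreasing rearrangement
-- of this block has at q. So the content of the block and the place of q determine x before any
-- rotated order is chosen.

inject₁<suc : ∀ {k} (i : Fin k) → inject₁ i F.< suc i
inject₁<suc i = s≤s (ℕₚ.≤-reflexive (Fₚ.toℕ-inject₁ i))

-- A cut vector I : Fin k → Bool splits Fin (suc k) into blocks: I i = true puts a
-- boundary between i and i+1.  block I numbers the blocks from 0.
block : ∀ {k} → (Fin k → Bool) → Fin (suc k) → Fin (suc k)
block I zero = zero
block {suc k} I (suc i) = if I zero then suc (block (I ∘ suc) i) else inject₁ (block (I ∘ suc) i)

block-mono : ∀ {k} (I : Fin k → Bool) {i j} → i F.≤ j → block I i F.≤ block I j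
block-mono I {zero} z≤n = z≤n
block-mono {suc k} I {suc i} {suc j} (s≤s i≤j) with I zero
... | true = s≤s (block-mono (I ∘ suc) i≤j)
... | false rewrite Fₚ.toℕ-inject₁ (block (I ∘ suc) i) | Fₚ.toℕ-inject₁ (block (I ∘ suc) j) =
  block-mono (I ∘ suc) i≤j

block-uncut : ∀ {k} (I : Fin k → Bool) i → I i ≡ false → block I (inject₁ i) ≡ block I (suc i)
block-uncut I zero eq rewrite eq = refl
block-uncut I (suc i) eq with I zero
... | true = cong suc (block-uncut (I ∘ suc) i eq)
... | false = cong inject₁ (block-uncut (I ∘ suc) i eq)

-- Equal block numbers force every boundary between i and j to be uncut, so the local inequalities
-- chain.
block-chain : ∀ {k} (I : Fin k → Bool) (f : Fin (suc k) → ℕ) →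
  (∀ i → I i ≡ false → f (inject₁ i) ≤ f (suc i)) →
  ∀ {i j} → i F.≤ j → block I i ≡ block I j → f i ≤ f j
block-chain I f h {zero} {zero} _ _ = ℕₚ.≤-refl
block-chain {suc k} I f h {zero} {suc j} _ eq with I zero in I0
... | false = ℕₚ.≤-trans (h zero I0)
  (block-chain (I ∘ suc) (f ∘ suc) (λ i → h (suc i)) {zero} {j} z≤n (Fₚ.inject₁-injective eq))
block-chain {suc k} I f h {suc i} {suc j} (s≤s i≤j) eq with I zero
... | true = block-chain (I ∘ suc) (f ∘ suc) (λ l → h (suc l)) i≤j (Fₚ.suc-injective eq)
... | false = block-chain (I ∘ suc) (f ∘ suc) (λ l → h (suc l)) i≤j (Fₚ.inject₁-injective eq)

swapIndex : ∀ {k} → Fin k → Fin (suc k) → Fin (suc k)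
swapIndex zero    zero          = suc zero
swapIndex zero    (suc zero)    = zero
swapIndex zero    (suc (suc j)) = suc (suc j)
swapIndex (suc i) zero          = zero
swapIndex (suc i) (suc j)       = suc (swapIndex i j)

swapIndex-involutive : ∀ {k} (i : Fin k) j → swapIndex i (swapIndex i j) ≡ j
swapIndex-involutive zero    zero          = refl
swapIndex-involutive zero    (suc zero)    = refl
swapIndex-involutive zero    (suc (suc j)) = refl
swapIndex-involutive (suc i) zero          = refl
swapIndex-involutive (suc i) (suc j)       = cong suc (swapIndex-involutive i j)

swapIndex-injective : ∀ {k} (i : Fin k) → Injective _≡_ _≡_ (swapIndex i)
swapIndex-injective i {a} {b} eq =
  trans (sym (swapIndex-involutive i a)) (trans (cong (swapIndex i) eq) (swapIndex-involutive i b))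

data SwapView {k} (i : Fin k) (j : Fin (suc k)) : Set where
  lower : j ≡ inject₁ i → swapIndex i j ≡ suc i → SwapView i j
  upper : j ≡ suc i → swapIndex i j ≡ inject₁ i → SwapView i j
  other : swapIndex i j ≡ j → SwapView i j

swapView : ∀ {k} (i : Fin k) j → SwapView i j
swapView zero    zero          = lower refl refl
swapView zero    (suc zero)    = upper refl refl
swapView zero    (suc (suc j)) = other refl
swapView (suc i) zero          = other refl
swapView (suc i) (suc j) with swapView i j
... | lower p q = lower (cong suc p) (cong suc q)
... | upper p q = upper (cong suc p) (cong suc q)
... | other p   = other (cong suc p)

block-swapIndex : ∀ {k} (I : Fin k → Bool) i → I i ≡ false →
  ∀ j → block I (swapIndex i j) ≡ block I j
block-swapIndex I i Ii j with swapView i j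
... | lower p q = trans (cong (block I) q) (trans (sym (block-uncut I i Ii)) (cong (block I) (sym p)))
... | upper p q = trans (cong (block I) q) (trans (block-uncut I i Ii) (cong (block I) (sym p)))
... | other p = cong (block I) p

module _ {L : Set} where

  swapAt : ∀ {k} → Fin k → Vec L (suc k) → Vec L (suc k)
  swapAt zero    (a ∷ b ∷ u) = b ∷ a ∷ u
  swapAt (suc i) (a ∷ u)     = a ∷ swapAt i u

  lookup-swapAt : ∀ {k} (i : Fin k) (u : Vec L (suc k)) j →
    lookup (swapAt i u) j ≡ lookup u (swapIndex i j)
  lookup-swapAt zero    (a ∷ b ∷ u) zero          = refl
  lookup-swapAt zero    (a ∷ b ∷ u) (suc zero)    = refl
  lookup-swapAt zero    (a ∷ b ∷ u) (suc (suc j)) = refl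
  lookup-swapAt (suc i) (a ∷ u)     zero          = refl
  lookup-swapAt (suc i) (a ∷ u)     (suc j)       = lookup-swapAt i u j

  -- A step need not repair an inversion: reachability is plain rearrangement within the blocks. An
  -- invariant of single swaps therefore passes through every sort, whatever its order.
  Step : ∀ {k} → (Fin k → Bool) → Vec L (suc k) → Vec L (suc k) → Set
  Step I u v = ∃ λ i → I i ≡ false × v ≡ swapAt i u

  _⊢_⟶*_ : ∀ {k} → (Fin k → Bool) → Vec L (suc k) → Vec L (suc k) → Set
  I ⊢ u ⟶* v = Star (Step I) u v

  ⟶*-cons : ∀ {k} {I : Fin (suc k) → Bool} a {u v} → (I ∘ suc) ⊢ u ⟶* v → I ⊢ (a ∷ u) ⟶* (a ∷ v)
  ⟶*-cons a = gmap (a ∷_) λ { (i , Ii , eq) → suc i , Ii , cong (a ∷_) eq }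

  ⟶*-weaken : ∀ {k} {I I′ : Fin k → Bool} → (∀ i → I′ i ≡ false → I i ≡ false) →
    ∀ {u v} → I′ ⊢ u ⟶* v → I ⊢ u ⟶* v
  ⟶*-weaken h = Star.map λ { (i , Ii , eq) → i , h i Ii , eq }

  ⟶*-preserves : ∀ {k} {I : Fin k → Bool} (P : Vec L (suc k) → Set) →
    (∀ i → I i ≡ false → ∀ u → P u → P (swapAt i u)) →
    ∀ {u v} → I ⊢ u ⟶* v → P u → P v
  ⟶*-preserves P h ε Pu = Pu
  ⟶*-preserves P h ((i , Ii , refl) ◅ s) Pu = ⟶*-preserves P h s (h i Ii _ Pu)

  insert : ∀ {k} → (L → ℕ) → (Fin k → Bool) → L → Vec L k → Vec L (suc k)
  insert κ I a [] = a ∷ []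
  insert κ I a (b ∷ u) with I zero | κ a ≤? κ b
  ... | true  | _     = a ∷ b ∷ u
  ... | false | yes _ = a ∷ b ∷ u
  ... | false | no _  = b ∷ insert κ (I ∘ suc) a u

  -- The key depends on the position because one block may be sorted in another direction than the
  -- rest. `insert` uses the key of the block's first visited position throughout, which
  -- `BlockConstant` justifies.
  sort : ∀ {k} → (Fin (suc k) → L → ℕ) → (Fin k → Bool) → Vec L (suc k) → Vec L (suc k)
  sort {zero}  κ I u       = u
  sort {suc k} κ I (a ∷ u) = insert (κ zero) I a (sort (κ ∘ suc) (I ∘ suc) u)

  Sorted : ∀ {k} → (Fin (suc k) → L → ℕ) → (Fin k → Bool) → Vec L (suc k) → Set
  Sorted κ I u = ∀ i → I i ≡ false →
    κ (inject₁ i) (lookup u (inject₁ i)) ≤ κ (inject₁ i) (lookup u (suc i))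

  BlockConstant : ∀ {k} → (Fin (suc k) → L → ℕ) → (Fin k → Bool) → Set
  BlockConstant κ I = ∀ i → I i ≡ false → ∀ a → κ (inject₁ i) a ≡ κ (suc i) a

  insert-cong : ∀ {k} {κ κ′ : L → ℕ} → (∀ a → κ a ≡ κ′ a) → (I : Fin k → Bool) → ∀ a u →
    insert κ I a u ≡ insert κ′ I a u
  insert-cong h I a [] = refl
  insert-cong {κ = κ} {κ′} h I a (b ∷ u) with I zero | κ a ≤? κ b | κ′ a ≤? κ′ b
  ... | true  | _     | _     = refl
  ... | false | yes _ | yes _ = refl
  ... | false | yes p | no ¬p = contradiction (subst₂ _≤_ (h a) (h b) p) ¬p
  ... | false | no ¬p | yes p = contradiction (subst₂ _≤_ (sym (h a)) (sym (h b)) p) ¬p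
  ... | false | no _  | no _  = cong (b ∷_) (insert-cong h (I ∘ suc) a u)

  insert-front : ∀ {k} (κ : L → ℕ) (I : Fin (suc k) → Bool) a b u → (I zero ≡ false → κ a ≤ κ b) →
    insert κ I a (b ∷ u) ≡ a ∷ b ∷ u
  insert-front κ I a b u h with I zero | κ a ≤? κ b
  ... | true  | _     = refl
  ... | false | yes _ = refl
  ... | false | no ¬p = contradiction (h refl) ¬p

  insert-behind : ∀ {k} (κ : L → ℕ) (I : Fin (suc k) → Bool) a b u → I zero ≡ false → ¬ κ a ≤ κ b →
    insert κ I a (b ∷ u) ≡ b ∷ insert κ (I ∘ suc) a u
  insert-behind κ I a b u I0 ¬p with I zero | κ a ≤? κ b
  ... | false | yes p = contradiction p ¬p
  ... | false | no _  = refl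

  insert-cut : ∀ {k} (κ : L → ℕ) (I : Fin (suc k) → Bool) a b u → I zero ≡ true →
    insert κ I a (b ∷ u) ≡ a ∷ b ∷ u
  insert-cut κ I a b u I0 = insert-front κ I a b u λ I0′ → contradiction (trans (sym I0) I0′) λ ()

  insert-comm-≤ : ∀ {k} (κ : L → ℕ) (I : Fin (suc k) → Bool) → I zero ≡ false → ∀ a b u →
    κ a ≤ κ b → ¬ κ b ≤ κ a →
    insert κ I a (insert κ (I ∘ suc) b u) ≡ insert κ I b (insert κ (I ∘ suc) a u)
  insert-comm-≤ κ I I0 a b [] a≤b b≰a =
    trans (insert-front κ I a b [] λ _ → a≤b) (sym (insert-behind κ I b a [] I0 b≰a))
  insert-comm-≤ κ I I0 a b (c ∷ u) a≤b b≰a with I (suc zero) in I1 | κ a ≤? κ c | κ b ≤? κ c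
  ... | true | _ | _ = begin
    insert κ I a (b ∷ c ∷ u)               ≡⟨ insert-front κ I a b (c ∷ u) (λ _ → a≤b) ⟩
    a ∷ b ∷ c ∷ u                          ≡⟨ cong (a ∷_) (insert-cut κ (I ∘ suc) b c u I1) ⟨
    a ∷ insert κ (I ∘ suc) b (c ∷ u)       ≡⟨ insert-behind κ I b a (c ∷ u) I0 b≰a ⟨
    insert κ I b (a ∷ c ∷ u)               ∎
    where open ≡-Reasoning
  ... | false | yes _ | yes b≤c = begin
    insert κ I a (b ∷ c ∷ u)               ≡⟨ insert-front κ I a b (c ∷ u) (λ _ → a≤b) ⟩
    a ∷ b ∷ c ∷ u                          ≡⟨ cong (a ∷_) (insert-front κ (I ∘ suc) b c u (λ _ → b≤c)) ⟨
    a ∷ insert κ (I ∘ suc) b (c ∷ u)       ≡⟨ insert-behind κ I b a (c ∷ u) I0 b≰a ⟨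
    insert κ I b (a ∷ c ∷ u)               ∎
    where open ≡-Reasoning
  ... | false | yes a≤c | no b≰c = begin
    insert κ I a (c ∷ insert κ ((I ∘ suc) ∘ suc) b u) ≡⟨ insert-front κ I a c _ (λ _ → a≤c) ⟩
    a ∷ c ∷ insert κ ((I ∘ suc) ∘ suc) b u   ≡⟨ cong (a ∷_) (insert-behind κ (I ∘ suc) b c u I1 b≰c) ⟨
    a ∷ insert κ (I ∘ suc) b (c ∷ u)       ≡⟨ insert-behind κ I b a (c ∷ u) I0 b≰a ⟨
    insert κ I b (a ∷ c ∷ u)               ∎
    where open ≡-Reasoning
  ... | false | no a≰c | yes b≤c = contradiction (ℕₚ.≤-trans a≤b b≤c) a≰c
  ... | false | no a≰c | no b≰c = begin
    insert κ I a (c ∷ insert κ ((I ∘ suc) ∘ suc) b u) ≡⟨ insert-behind κ I a c _ I0 a≰c ⟩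
    c ∷ insert κ (I ∘ suc) a (insert κ ((I ∘ suc) ∘ suc) b u)
      ≡⟨ cong (c ∷_) (insert-comm-≤ κ (I ∘ suc) I1 a b u a≤b b≰a) ⟩
    c ∷ insert κ (I ∘ suc) b (insert κ ((I ∘ suc) ∘ suc) a u) ≡⟨ insert-behind κ I b c _ I0 b≰c ⟨
    insert κ I b (c ∷ insert κ ((I ∘ suc) ∘ suc) a u) ∎
    where open ≡-Reasoning

  -- An injective key makes tied letters equal, so ties leave nothing to choose.
  insert-comm : ∀ {k} (κ : L → ℕ) → Injective _≡_ _≡_ κ → (I : Fin (suc k) → Bool) →
    I zero ≡ false → ∀ a b u →
    insert κ I a (insert κ (I ∘ suc) b u) ≡ insert κ I b (insert κ (I ∘ suc) a u)
  insert-comm κ inj I I0 a b u with κ a ≤? κ b | κ b ≤? κ a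
  ... | yes p | yes q with refl ← inj (ℕₚ.≤-antisym p q) = refl
  ... | yes p | no ¬q = insert-comm-≤ κ I I0 a b u p ¬q
  ... | no ¬p | yes q = sym (insert-comm-≤ κ I I0 b a u q ¬p)
  ... | no ¬p | no ¬q with ℕₚ.≤-total (κ a) (κ b)
  ...   | inj₁ p = contradiction p ¬p
  ...   | inj₂ q = contradiction q ¬q

  sort-sorted-id : ∀ {k} κ (I : Fin k → Bool) u → Sorted κ I u → sort κ I u ≡ u
  sort-sorted-id {zero}  κ I u       s = refl
  sort-sorted-id {suc k} κ I (a ∷ b ∷ u) s
    rewrite sort-sorted-id (κ ∘ suc) (I ∘ suc) (b ∷ u) (λ i → s (suc i)) =
    insert-front (κ zero) I a b u (s zero)

  sort-swapAt : ∀ {k} κ (I : Fin k → Bool) → (∀ i → Injective _≡_ _≡_ (κ i)) → BlockConstant κ I →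
    ∀ i → I i ≡ false → ∀ u → sort κ I (swapAt i u) ≡ sort κ I u
  sort-swapAt {suc zero} κ I inj const zero I0 (a ∷ b ∷ []) = insert-comm (κ zero) (inj zero) I I0 b a []
  sort-swapAt {suc (suc k)} κ I inj const zero I0 (a ∷ b ∷ u) = begin
    insert κ₀ I b (insert (κ (suc zero)) I₁ a v) ≡⟨ cong (insert κ₀ I b) (insert-cong eq I₁ a v) ⟩
    insert κ₀ I b (insert κ₀ I₁ a v)             ≡⟨ insert-comm κ₀ (inj zero) I I0 b a v ⟩
    insert κ₀ I a (insert κ₀ I₁ b v)             ≡⟨ cong (insert κ₀ I a) (insert-cong eq I₁ b v) ⟨
    insert κ₀ I a (insert (κ (suc zero)) I₁ b v) ∎
    where
    open ≡-Reasoning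
    κ₀ = κ zero
    I₁ = I ∘ suc
    v = sort ((κ ∘ suc) ∘ suc) ((I ∘ suc) ∘ suc) u
    eq : ∀ c → κ (suc zero) c ≡ κ₀ c
    eq c = sym (const zero I0 c)
  sort-swapAt {suc k} κ I inj const (suc i) Ii (a ∷ u) = cong (insert (κ zero) I a)
    (sort-swapAt (κ ∘ suc) (I ∘ suc) (λ j → inj (suc j)) (λ j → const (suc j)) i Ii u)

  -- Makes `sort` a normal form for rearrangement within blocks. With `sort-sorted-id` it shows that
  -- sorting undoes any scrambling of a sorted word, and both inverse laws of `pivotSort` and
  -- `plainSort` rest on this.
  sort-⟶* : ∀ {k} κ (I : Fin k → Bool) → (∀ i → Injective _≡_ _≡_ (κ i)) → BlockConstant κ I →
    ∀ {u v} → I ⊢ u ⟶* v → sort κ I v ≡ sort κ I u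
  sort-⟶* κ I inj const {u} s = ⟶*-preserves (λ v → sort κ I v ≡ sort κ I u)
    (λ i Ii v eq → trans (sort-swapAt κ I inj const i Ii v) eq) s refl

  insert-sorted : ∀ {k} κ (I : Fin (suc k) → Bool) → BlockConstant κ I → ∀ a u →
    Sorted (κ ∘ suc) (I ∘ suc) u → Sorted κ I (insert (κ zero) I a u)
  insert-sorted κ I const a (b ∷ u) s with I zero in I0 | κ zero a ≤? κ zero b
  insert-sorted κ I const a (b ∷ u) s | true | _ = λ
    { zero I0′ → contradiction (trans (sym I0) I0′) λ () ; (suc i) → s i }
  insert-sorted κ I const a (b ∷ u) s | false | yes p = λ { zero _ → p ; (suc i) → s i }
  insert-sorted κ I const a (b ∷ []) s | false | no ¬p = λ { zero _ → ℕₚ.<⇒≤ (ℕₚ.≰⇒> ¬p) }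
  insert-sorted κ I const a (b ∷ c ∷ u) s | false | no ¬p = λ
    { zero _ → head
    ; (suc i) → subst (Sorted (κ ∘ suc) (I ∘ suc)) eq
        (insert-sorted (κ ∘ suc) (I ∘ suc) (λ j → const (suc j)) a (c ∷ u) (λ j → s (suc j))) i }
    where
    b≤a = ℕₚ.<⇒≤ (ℕₚ.≰⇒> ¬p)
    eq : insert (κ (suc zero)) (I ∘ suc) a (c ∷ u) ≡ insert (κ zero) (I ∘ suc) a (c ∷ u)
    eq = insert-cong (λ d → sym (const zero I0 d)) (I ∘ suc) a (c ∷ u)
    head : κ zero b ≤ κ zero (lookup (insert (κ zero) (I ∘ suc) a (c ∷ u)) zero)
    head with I (suc zero) in I1 | κ zero a ≤? κ zero c
    ... | true  | _     = b≤a
    ... | false | yes _ = b≤a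
    ... | false | no _  = subst₂ _≤_ (sym (const zero I0 b)) (sym (const zero I0 c)) (s zero I1)

  sort-sorted : ∀ {k} κ (I : Fin k → Bool) → BlockConstant κ I → ∀ u → Sorted κ I (sort κ I u)
  sort-sorted {zero}  κ I const u ()
  sort-sorted {suc k} κ I const (a ∷ u) = insert-sorted κ I const a (sort (κ ∘ suc) (I ∘ suc) u)
    (sort-sorted (κ ∘ suc) (I ∘ suc) (λ j → const (suc j)) u)

  insert-⟶* : ∀ {k} κ (I : Fin k → Bool) a u → I ⊢ (a ∷ u) ⟶* insert κ I a u
  insert-⟶* κ I a [] = ε
  insert-⟶* κ I a (b ∷ u) with I zero in I0 | κ a ≤? κ b
  ... | true  | _     = ε
  ... | false | yes _ = ε
  ... | false | no _  = (zero , I0 , refl) ◅ ⟶*-cons b (insert-⟶* κ (I ∘ suc) a u)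

  ⟶*-sort : ∀ {k} κ (I : Fin k → Bool) u → I ⊢ u ⟶* sort κ I u
  ⟶*-sort {zero}  κ I u = ε
  ⟶*-sort {suc k} κ I (a ∷ u) =
    ⟶*-cons a (⟶*-sort (κ ∘ suc) (I ∘ suc) u) ◅◅ insert-⟶* (κ zero) I a _

-- The bijection between plainly sorted and pivot-sorted words

opposite-anti-≤ : ∀ {n} {a b : Fin n} → a F.≤ b → opposite b F.≤ opposite a
opposite-anti-≤ {n} {a} {b} a≤b rewrite Fₚ.opposite-prop a | Fₚ.opposite-prop b =
  ℕₚ.∸-monoʳ-≤ n (s≤s a≤b)

opposite-anti-≤⁻ : ∀ {n} {a b : Fin n} → opposite b F.≤ opposite a → a F.≤ b
opposite-anti-≤⁻ {a = a} {b} h =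
  subst₂ F._≤_ (Fₚ.opposite-involutive a) (Fₚ.opposite-involutive b) (opposite-anti-≤ h)

ascending : ∀ {k ℓ} → Fin k → Fin ℓ → ℕ
ascending _ = toℕ

module Pivot {k ℓ : ℕ} (I : Fin k → Bool) (q : Fin (suc k)) where

  Letters = Vec (Fin ℓ) (suc k)

  -- The flag selects the letters that come first. The offset is ℓ + ℓ and not ℓ, so that the key ℓ
  -- reserved for the pivot lies strictly between the two groups; with ℓ the letter 0 would tie with
  -- it.
  raised : Bool → Fin ℓ → ℕ
  raised b a = if b then toℕ a else ℓ + ℓ + toℕ a

  raised-injective : ∀ b c {a a′} → raised b a ≡ raised c a′ → a ≡ a′
  raised-injective true  true  eq = Fₚ.toℕ-injective eq
  raised-injective true  false {a} {a′} eq =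
    contradiction eq (ℕₚ.<⇒≢ (ℕₚ.<-≤-trans (Fₚ.toℕ<n a) (ℕₚ.≤-trans (ℕₚ.m≤m+n ℓ ℓ) (ℕₚ.m≤m+n (ℓ + ℓ) _))))
  raised-injective false true  {a} {a′} eq =
    contradiction (sym eq) (ℕₚ.<⇒≢ (ℕₚ.<-≤-trans (Fₚ.toℕ<n a′) (ℕₚ.≤-trans (ℕₚ.m≤m+n ℓ ℓ) (ℕₚ.m≤m+n (ℓ + ℓ) _))))
  raised-injective false false eq = Fₚ.toℕ-injective (ℕₚ.+-cancelˡ-≡ (ℓ + ℓ) _ _ eq)

  raised-below : ∀ b {a} → raised b a ≤ ℓ → b ≡ true
  raised-below true  _ = refl
  raised-below false {a} h = contradiction
    (ℕₚ.≤-<-trans h (ℕₚ.≤-<-trans (ℕₚ.m≤m+n ℓ (toℕ a)) (ℕₚ.+-monoˡ-< (toℕ a) (ℕₚ.m<m+n ℓ (ℕₚ.≤-<-trans z≤n (Fₚ.toℕ<n a))))))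
    (ℕₚ.<-irrefl refl)

  raised-above : ∀ b {a} → ℓ ≤ raised b a → b ≡ false
  raised-above false _ = refl
  raised-above true  {a} h = contradiction (ℕₚ.≤-<-trans h (Fₚ.toℕ<n a)) (ℕₚ.<-irrefl refl)

  -- The letters in their order rotated to start at the pivot letter x; x itself comes
  -- first at positions before q and last at positions after q.
  upperHalf : Fin ℓ → Fin (suc k) → Fin ℓ → Bool
  upperHalf x i a = if does (i F.<? q) then does (x F.≤? a) else does (x F.<? a)

  rotated : Fin ℓ → Fin (suc k) → Fin ℓ → ℕ
  rotated x i a = raised (upperHalf x i a) a

  rotatedAround : Fin ℓ → Fin (suc k) → Fin ℓ → ℕ
  rotatedAround x i a = if does (i F.≟ q) then ℓ else rotated x i a

  descendingAt : Fin (suc k) → Fin ℓ → ℕ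
  descendingAt i a = if does (block I i F.≟ block I q) then toℕ (opposite a) else toℕ a

  -- Makes q a block of its own. Swaps inside these blocks keep the pivot letter and carry nothing
  -- across q, so `rotated x` is constant on them, although it may change at q within a block of
  -- `I`.
  cutAround : Fin k → Bool
  cutAround i = I i ∨ (does (suc i F.≟ q) ∨ does (inject₁ i F.≟ q))

  cutAround⁻ : ∀ i → cutAround i ≡ false → I i ≡ false × suc i ≢ q × inject₁ i ≢ q
  cutAround⁻ i eq with I i | suc i F.≟ q | inject₁ i F.≟ q
  cutAround⁻ i eq | false | no p | no r = refl , p , r

  cutAround⁺ : ∀ i → I i ≡ false → suc i ≢ q → inject₁ i ≢ q → cutAround i ≡ false
  cutAround⁺ i Ii p r rewrite Ii | dec-false (suc i F.≟ q) p | dec-false (inject₁ i F.≟ q) r = refl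

  cutAround⇒I : ∀ i → cutAround i ≡ false → I i ≡ false
  cutAround⇒I i eq = proj₁ (cutAround⁻ i eq)

  rotatedAround-pivot : ∀ x a → rotatedAround x q a ≡ ℓ
  rotatedAround-pivot x a rewrite dec-true (q F.≟ q) refl = refl

  rotatedAround-off : ∀ x i a → i ≢ q → rotatedAround x i a ≡ rotated x i a
  rotatedAround-off x i a i≢q rewrite dec-false (i F.≟ q) i≢q = refl

  upperHalf-before : ∀ x i a → i F.< q → upperHalf x i a ≡ does (x F.≤? a)
  upperHalf-before x i a i<q rewrite dec-true (i F.<? q) i<q = refl

  upperHalf-after : ∀ x i a → q F.≤ i → upperHalf x i a ≡ does (x F.<? a)
  upperHalf-after x i a q≤i rewrite dec-false (i F.<? q) (ℕₚ.≤⇒≯ q≤i) = refl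

  descendingAt-row : ∀ i a → block I i ≡ block I q → descendingAt i a ≡ toℕ (opposite a)
  descendingAt-row i a eq rewrite dec-true (block I i F.≟ block I q) eq = refl

  ascending-injective : ∀ (i : Fin (suc k)) → Injective _≡_ _≡_ (ascending {ℓ = ℓ} i)
  ascending-injective i = Fₚ.toℕ-injective

  descendingAt-injective : ∀ i → Injective _≡_ _≡_ (descendingAt i)
  descendingAt-injective i {a} {b} eq with does (block I i F.≟ block I q)
  ... | true  = trans (sym (Fₚ.opposite-involutive a))
    (trans (cong opposite (Fₚ.toℕ-injective eq)) (Fₚ.opposite-involutive b))
  ... | false = Fₚ.toℕ-injective eq

  rotated-injective : ∀ x i → Injective _≡_ _≡_ (rotated x i)
  rotated-injective x i {a} {b} = raised-injective (upperHalf x i a) (upperHalf x i b)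

  ascending-constant : BlockConstant (ascending {ℓ = ℓ}) I
  ascending-constant i Ii a = refl

  descendingAt-constant : BlockConstant descendingAt I
  descendingAt-constant i Ii a rewrite block-uncut I i Ii = refl

  descendingAt-constant′ : BlockConstant descendingAt cutAround
  descendingAt-constant′ i eq = descendingAt-constant i (cutAround⇒I i eq)

  step-before : ∀ (i : Fin k) → suc i F.< q → inject₁ i F.< q
  step-before i = ℕₚ.<-trans (inject₁<suc i)

  step-after : ∀ (i : Fin k) → inject₁ i ≢ q → q F.< suc i → q F.< inject₁ i
  step-after i i≢q (s≤s q≤i) = ℕₚ.≤∧≢⇒< (subst (toℕ q ≤_) (sym (Fₚ.toℕ-inject₁ i)) q≤i)
    λ eq → i≢q (Fₚ.toℕ-injective (sym eq))

  rotated-constant : ∀ x → BlockConstant (rotated x) cutAround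
  rotated-constant x i eq a with Ii , si≢q , i≢q ← cutAround⁻ i eq with Fₚ.<-cmp (suc i) q
  ... | tri< si<q _ _
    rewrite upperHalf-before x (suc i) a si<q
          | upperHalf-before x (inject₁ i) a (step-before i si<q) = refl
  ... | tri≈ _ si≡q _ = contradiction si≡q si≢q
  ... | tri> _ _ q<si
    rewrite upperHalf-after x (suc i) a (ℕₚ.<⇒≤ q<si)
          | upperHalf-after x (inject₁ i) a (ℕₚ.<⇒≤ (step-after i i≢q q<si)) = refl

  -- The link between the decreasing and the rotated sorting: it concerns only which letters lie on
  -- which side of q, so it survives every swap along `cutAround`.
  Split : Letters → Set
  Split y = ∀ i → block I i ≡ block I q →
    (i F.< q → lookup y q F.≤ lookup y i) × (q F.< i → lookup y i F.≤ lookup y q)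

  pivot-swapAt : ∀ j → cutAround j ≡ false → ∀ (y : Letters) → lookup (swapAt j y) q ≡ lookup y q
  pivot-swapAt j eq y with _ , sj≢q , j≢q ← cutAround⁻ j eq with swapView j q
  ... | lower p _ = contradiction (sym p) j≢q
  ... | upper p _ = contradiction (sym p) sj≢q
  ... | other p = trans (lookup-swapAt j y q) (cong (lookup y) p)

  swapIndex-before : ∀ j → cutAround j ≡ false → ∀ i → i F.< q → swapIndex j i F.< q
  swapIndex-before j eq i i<q with _ , sj≢q , j≢q ← cutAround⁻ j eq with swapView j i
  ... | lower refl r = subst (F._< q) (sym r)
    (ℕₚ.≤∧≢⇒< (subst (_< toℕ q) (Fₚ.toℕ-inject₁ j) i<q) (sj≢q ∘ Fₚ.toℕ-injective))
  ... | upper refl r = subst (F._< q) (sym r) (step-before j i<q)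
  ... | other r = subst (F._< q) (sym r) i<q

  swapIndex-after : ∀ j → cutAround j ≡ false → ∀ i → q F.< i → q F.< swapIndex j i
  swapIndex-after j eq i q<i with _ , sj≢q , j≢q ← cutAround⁻ j eq with swapView j i
  ... | lower refl r = subst (q F.<_) (sym r) (ℕₚ.m<n⇒m<1+n (subst (toℕ q <_) (Fₚ.toℕ-inject₁ j) q<i))
  ... | upper refl r = subst (q F.<_) (sym r) (step-after j j≢q q<i)
  ... | other r = subst (q F.<_) (sym r) q<i

  Split-swapAt : ∀ j → cutAround j ≡ false → ∀ y → Split y → Split (swapAt j y)
  Split-swapAt j eq y s i row
    rewrite pivot-swapAt j eq y | lookup-swapAt j y i
    with before , after ← s (swapIndex j i)
      (trans (block-swapIndex I j (cutAround⇒I j eq) i) row) =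
    (λ i<q → before (swapIndex-before j eq i i<q)) , (λ q<i → after (swapIndex-after j eq i q<i))

  Split-⟶* : ∀ {y y′} → cutAround ⊢ y ⟶* y′ → Split y → Split y′
  Split-⟶* = ⟶*-preserves Split Split-swapAt

  pivot-⟶* : ∀ {y y′} → cutAround ⊢ y ⟶* y′ → lookup y′ q ≡ lookup y q
  pivot-⟶* {y} s = ⟶*-preserves (λ y′ → lookup y′ q ≡ lookup y q)
    (λ j eq y′ e → trans (pivot-swapAt j eq y′) e) s refl

  descending⇒split : ∀ y → Sorted descendingAt I y → Split y
  descending⇒split y s i row =
    (λ i<q → opposite-anti-≤⁻ (subst₂ _≤_ (descendingAt-row i _ row) (descendingAt-row q _ refl)
      (chain (ℕₚ.<⇒≤ i<q) row))) ,
    (λ q<i → opposite-anti-≤⁻ (subst₂ _≤_ (descendingAt-row q _ refl) (descendingAt-row i _ row)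
      (chain (ℕₚ.<⇒≤ q<i) (sym row))))
    where
    f : Fin (suc k) → ℕ
    f i = descendingAt i (lookup y i)
    chain : ∀ {i j} → i F.≤ j → block I i ≡ block I j → f i ≤ f j
    chain = block-chain I f λ i Ii →
      subst (f (inject₁ i) ≤_) (descendingAt-constant i Ii (lookup y (suc i))) (s i Ii)

  -- Only the two boundaries next to q are cut by `cutAround` and not by `I`; there `Split` supplies
  -- the missing inequality.
  split⇒descending : ∀ y → Sorted descendingAt cutAround y → Split y → Sorted descendingAt I y
  split⇒descending y s split i Ii with suc i F.≟ q | inject₁ i F.≟ q
  ... | yes refl | _ = subst₂ _≤_ (sym (descendingAt-row (inject₁ i) _ (block-uncut I i Ii)))
    (sym (descendingAt-row (inject₁ i) _ (block-uncut I i Ii)))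
    (opposite-anti-≤ (proj₁ (split (inject₁ i) (block-uncut I i Ii))
      (inject₁<suc i)))
  ... | no _ | yes refl = subst₂ _≤_ (sym (descendingAt-row (inject₁ i) _ refl))
    (sym (descendingAt-row (inject₁ i) _ refl))
    (opposite-anti-≤ (proj₂ (split (suc i) (sym (block-uncut I i Ii)))
      (inject₁<suc i)))
  ... | no p | no r = s i (cutAround⁺ i Ii p r)

  -- Unlike in `Sorted`, each letter is measured by the key of its own position, because the key
  -- changes at q inside a block; the order also refers to the word's own pivot letter.
  RotatedSorted : Letters → Set
  RotatedSorted y = ∀ i → I i ≡ false →
    rotatedAround (lookup y q) (inject₁ i) (lookup y (inject₁ i)) ≤
    rotatedAround (lookup y q) (suc i) (lookup y (suc i))

  -- Within its block the pivot has key ℓ, and the side of ℓ on which another key falls reveals its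
  -- flag, hence the comparison with x.
  rotated⇒split : ∀ y → RotatedSorted y → Split y
  rotated⇒split y s i row = before , after
    where
    x = lookup y q
    f : Fin (suc k) → ℕ
    f i = rotatedAround x i (lookup y i)
    before : i F.< q → x F.≤ lookup y i
    before i<q with x F.≤? lookup y i in e
    ... | yes p = p
    ... | no ¬p = contradiction (trans (sym (raised-below _ bound))
            (trans (upperHalf-before x i (lookup y i) i<q) (cong does e))) λ ()
      where
      bound : rotated x i (lookup y i) ≤ ℓ
      bound = subst₂ _≤_ (rotatedAround-off x i _ (λ eq → Fₚ.<-irrefl eq i<q)) (rotatedAround-pivot x _)
        (block-chain I f s (ℕₚ.<⇒≤ i<q) row)
    after : q F.< i → lookup y i F.≤ x
    after q<i with x F.<? lookup y i in e
    ... | no ¬p = ℕₚ.≮⇒≥ ¬p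
    ... | yes p = contradiction (trans (sym (raised-above _ bound))
            (trans (upperHalf-after x i (lookup y i) (ℕₚ.<⇒≤ q<i)) (cong does e))) λ ()
      where
      bound : ℓ ≤ rotated x i (lookup y i)
      bound = subst₂ _≤_ (rotatedAround-pivot x _)
        (rotatedAround-off x i _ (λ eq → Fₚ.<-irrefl (sym eq) q<i))
        (block-chain I f s (ℕₚ.<⇒≤ q<i) (sym row))

  rotated⇒sorted : ∀ y → RotatedSorted y → Sorted (rotated (lookup y q)) cutAround y
  rotated⇒sorted y s i eq with Ii , si≢q , i≢q ← cutAround⁻ i eq =
    subst₂ _≤_ (rotatedAround-off _ _ _ i≢q)
      (trans (rotatedAround-off _ _ _ si≢q) (sym (rotated-constant _ i eq _))) (s i Ii)

  sorted⇒rotated : ∀ y → Sorted (rotated (lookup y q)) cutAround y → Split y → RotatedSorted y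
  sorted⇒rotated y s split i Ii with suc i F.≟ q | inject₁ i F.≟ q in e
  ... | yes refl | yes p = contradiction p (λ p → Fₚ.<-irrefl p (inject₁<suc i))
  ... | yes refl | no i≢q = subst (_≤ ℓ) (sym key) (ℕₚ.<⇒≤ (Fₚ.toℕ<n _))
    where
    i<q : inject₁ i F.< suc i
    i<q = inject₁<suc i
    x≤y = proj₁ (split (inject₁ i) (block-uncut I i Ii)) i<q
    key : rotated (lookup y q) (inject₁ i) (lookup y (inject₁ i)) ≡ toℕ (lookup y (inject₁ i))
    key = cong (λ b → raised b (lookup y (inject₁ i)))
      (trans (upperHalf-before (lookup y q) _ (lookup y (inject₁ i)) i<q) (dec-true (lookup y q F.≤? _) x≤y))
  ... | no si≢q | yes refl = subst (ℓ ≤_) (sym key) (ℕₚ.≤-trans (ℕₚ.m≤m+n ℓ ℓ) (ℕₚ.m≤m+n (ℓ + ℓ) _))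
    where
    q<si : inject₁ i F.< suc i
    q<si = inject₁<suc i
    y≤x = proj₂ (split (suc i) (sym (block-uncut I i Ii))) q<si
    key : rotated (lookup y q) (suc i) (lookup y (suc i)) ≡ ℓ + ℓ + toℕ (lookup y (suc i))
    key = cong (λ b → raised b (lookup y (suc i)))
      (trans (upperHalf-after (lookup y q) (suc i) (lookup y (suc i)) (ℕₚ.<⇒≤ q<si)) (dec-false (lookup y q F.<? _) (ℕₚ.≤⇒≯ y≤x)))
  ... | no si≢q | no i≢q = subst (rotated _ _ _ ≤_) (rotated-constant _ i eq _) (s i eq)
    where eq = cutAround⁺ i Ii si≢q i≢q

  opaque
    pivotSort : Letters → Letters
    pivotSort z = sort (rotated (lookup (sort descendingAt I z) q)) cutAround (sort descendingAt I z)

    plainSort : Letters → Letters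
    plainSort = sort ascending I

    ⟶*-pivotSort : ∀ z → I ⊢ z ⟶* pivotSort z
    ⟶*-pivotSort z = ⟶*-sort descendingAt I z ◅◅
      ⟶*-weaken cutAround⇒I (⟶*-sort (rotated (lookup (sort descendingAt I z) q)) cutAround _)

    ⟶*-plainSort : ∀ y → I ⊢ y ⟶* plainSort y
    ⟶*-plainSort = ⟶*-sort ascending I

    plainSort-sorted : ∀ y → Sorted ascending I (plainSort y)
    plainSort-sorted = sort-sorted ascending I ascending-constant

    pivotSort-sorted : ∀ z → RotatedSorted (pivotSort z)
    pivotSort-sorted z = sorted⇒rotated (pivotSort z)
      (subst (λ x → Sorted (rotated x) cutAround (pivotSort z)) (sym (pivot-⟶* steps))
        (sort-sorted (rotated x) cutAround (rotated-constant x) y))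
      (Split-⟶* steps (descending⇒split y (sort-sorted descendingAt I descendingAt-constant z)))
      where
      y : Letters
      y = sort descendingAt I z
      x : Fin ℓ
      x = lookup y q
      steps : cutAround ⊢ y ⟶* pivotSort z
      steps = ⟶*-sort (rotated x) cutAround y

    plainSort-pivotSort : ∀ z → Sorted ascending I z → plainSort (pivotSort z) ≡ z
    plainSort-pivotSort z s = trans
      (sort-⟶* ascending I ascending-injective ascending-constant (⟶*-pivotSort z))
      (sort-sorted-id ascending I z s)

    -- The word `y₀` re-sorts `y` without moving its pivot. By `Split` it is decreasing on the whole
    -- block of q, so it is what the first stage of `pivotSort` makes of `plainSort y`. The second
    -- stage then rearranges only along `cutAround`, and leads back to `y`.
    pivotSort-plainSort : ∀ y → RotatedSorted y → pivotSort (plainSort y) ≡ y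
    pivotSort-plainSort y s = begin
      pivotSort (plainSort y)                        ≡⟨ cong (λ v → sort (rotated (lookup v q)) cutAround v) same ⟩
      sort (rotated (lookup y₀ q)) cutAround y₀      ≡⟨ cong (λ x → sort (rotated x) cutAround y₀) (pivot-⟶* steps) ⟩
      sort (rotated (lookup y q)) cutAround y₀
        ≡⟨ sort-⟶* _ cutAround (rotated-injective _) (rotated-constant _) steps ⟩
      sort (rotated (lookup y q)) cutAround y        ≡⟨ sort-sorted-id _ cutAround y (rotated⇒sorted y s) ⟩
      y                                              ∎
      where
      open ≡-Reasoning
      y₀ : Letters
      y₀ = sort descendingAt cutAround y
      steps : cutAround ⊢ y ⟶* y₀
      steps = ⟶*-sort descendingAt cutAround y
      same : sort descendingAt I (plainSort y) ≡ y₀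
      same = begin
        sort descendingAt I (plainSort y)
          ≡⟨ sort-⟶* descendingAt I descendingAt-injective descendingAt-constant (⟶*-plainSort y) ⟩
        sort descendingAt I y
          ≡⟨ sort-⟶* descendingAt I descendingAt-injective descendingAt-constant (⟶*-weaken cutAround⇒I steps) ⟨
        sort descendingAt I y₀
          ≡⟨ sort-sorted-id descendingAt I y₀ (split⇒descending y₀
               (sort-sorted descendingAt cutAround descendingAt-constant′ y)
               (Split-⟶* steps (rotated⇒split y s))) ⟩
        y₀ ∎

-- Permutations with prescribed inverse descents as words

lookup-ext : ∀ {A : Set} {n} {u v : Vec A n} → (∀ i → lookup u i ≡ lookup v i) → u ≡ v
lookup-ext {u = u} {v} h = trans (sym (tabulate∘lookup u)) (trans (tabulate-cong h) (tabulate∘lookup v))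

injective⇒surjective : ∀ {n} {f : Fin n → Fin n} → Injective _≡_ _≡_ f → ∀ j → ∃ λ i → f i ≡ j
injective⇒surjective {suc n} {f} inj j with Fₚ.any? (λ i → f i F.≟ j)
... | yes p = p
... | no ¬p = contradiction
  (Fₚ.injective⇒≤ {f = λ i → punchOut (avoid i)} λ {a} {b} eq → inj (Fₚ.punchOut-injective (avoid a) (avoid b) eq))
  ℕₚ.1+n≰n
  where
  avoid : ∀ i → j ≢ f i
  avoid i eq = ¬p (i , sym eq)

inv-right : ∀ {n} (π : Word n) → IsPerm π → ∀ j → lookup π (lookup (inv π) j) ≡ j
inv-right π perm j with Fₚ.any? (λ i → lookup π i F.≟ j) | (lookup (inv π) j ≡ _ ∋ lookup∘tabulate _ j)
... | yes (i , p) | eq = trans (cong (lookup π) eq) p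
... | no ¬p       | _  = contradiction (injective⇒surjective (λ {a} {b} → perm a b) j) ¬p

inv-left : ∀ {n} (π : Word n) → IsPerm π → ∀ i → lookup (inv π) (lookup π i) ≡ i
inv-left π perm i = perm _ _ (inv-right π perm (lookup π i))

inv-perm : ∀ {n} (π : Word n) → IsPerm π → IsPerm (inv π)
inv-perm π perm i j eq = trans (sym (inv-right π perm i)) (trans (cong (lookup π) eq) (inv-right π perm j))

inv-inv : ∀ {n} (π : Word n) → IsPerm π → inv (inv π) ≡ π
inv-inv π perm = lookup-ext λ i → inv-perm π perm _ _
  (trans (inv-right (inv π) (inv-perm π perm) i) (sym (inv-left π perm i)))

-- The last position of Fin (suc (suc m)) always forms a block of its own.
cuts : ∀ {m} → Subset m → Fin (suc m) → Bool
cuts []      zero    = true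
cuts (b ∷ I) zero    = b
cuts (b ∷ I) (suc i) = cuts I i

cuts-inject₁ : ∀ {m} (I : Subset m) i → cuts I (inject₁ i) ≡ lookup I i
cuts-inject₁ (b ∷ I) zero    = refl
cuts-inject₁ (b ∷ I) (suc i) = cuts-inject₁ I i

cuts-last : ∀ {m} (I : Subset m) → cuts I (fromℕ m) ≡ true
cuts-last []      = refl
cuts-last (b ∷ I) = cuts-last I

-- Lets the value n be recognised by its letter, so that a word alone shows whether its permutation
-- fixes n.
block-last : ∀ {m} (I : Subset m) i → block (cuts I) i ≡ block (cuts I) (fromℕ (suc m)) → i ≡ fromℕ (suc m)
block-last []          (suc zero) eq = refl
block-last (true ∷ I)  (suc i) eq = cong suc (block-last I i (Fₚ.suc-injective eq))
block-last (false ∷ I) zero    eq =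
  contradiction (block-last I zero (Fₚ.inject₁-injective eq)) λ ()
block-last (false ∷ I) (suc i) eq = cong suc (block-last I i (Fₚ.inject₁-injective eq))

_⊑_ : ∀ {m} → Subset m → Subset m → Set
I′ ⊑ I = ∀ i → lookup I i ≡ false → lookup I′ i ≡ false

AscendsOff : ∀ {m} → Subset m → (Fin (suc (suc m)) → Fin (suc (suc m))) → Set
AscendsOff I f = ∀ i → cuts I i ≡ false → f (inject₁ i) F.≤ f (suc i)

lookup-Des : ∀ {m} (σ : Word (suc (suc m))) i →
  lookup (Des σ) i ≡ does (lookup σ (inject₁ (suc i)) F.<? lookup σ (inject₁ (inject₁ i)))
lookup-Des σ i = lookup∘tabulate _ i

Des⊑⇒ascends : ∀ {m} (I : Subset m) σ → Des σ ⊑ I → AscendsOff I (lookup σ)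
Des⊑⇒ascends {m} I σ h i eq with view i
... | ‵fromℕ = contradiction (trans (sym (cuts-last I)) eq) λ ()
... | ‵inj₁ {i = j} _ with lookup σ (inject₁ (suc j)) F.<? lookup σ (inject₁ (inject₁ j)) in e
...   | no ¬p = ℕₚ.≮⇒≥ ¬p
...   | yes p = contradiction
  (trans (sym (h j (trans (sym (cuts-inject₁ I j)) eq))) (trans (lookup-Des σ j) (cong does e))) λ ()

ascends⇒Des⊑ : ∀ {m} (I : Subset m) σ → AscendsOff I (lookup σ) → Des σ ⊑ I
ascends⇒Des⊑ I σ h i eq = trans (lookup-Des σ i)
  (dec-false (_ F.<? _) (ℕₚ.≤⇒≯ (h (inject₁ i) (trans (cuts-inject₁ I i) eq))))

module Columns {m : ℕ} (J : Subset m) where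

  private
    n : ℕ
    n = suc (suc m)

  col : Fin n → Fin n
  col = block (cuts J)

  -- For a permutation, this says that σ is the standardization of the word of its columns: equal
  -- letters are numbered from left to right.
  ColumnSorted : Word n → Set
  ColumnSorted σ = ∀ {i j} → i F.< j → col (lookup σ i) ≡ col (lookup σ j) → lookup σ i F.< lookup σ j

  ascends⇒columnSorted : ∀ (f g : Word n) → (∀ i → lookup f (lookup g i) ≡ i) →
    AscendsOff J (lookup f) → ColumnSorted g
  ascends⇒columnSorted f g fg asc {i} {j} i<j eq with lookup g i F.<? lookup g j
  ... | yes p = p
  ... | no ¬p = contradiction
    (subst₂ F._≤_ (fg j) (fg i) (block-chain (cuts J) (toℕ ∘ lookup f) asc (ℕₚ.≮⇒≥ ¬p) (sym eq)))
    (ℕₚ.<⇒≱ i<j)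

  columnSorted⇒ascends : ∀ σ → IsPerm σ → ColumnSorted σ → AscendsOff J (lookup (inv σ))
  columnSorted⇒ascends σ perm cs a eq with lookup (inv σ) (suc a) F.<? lookup (inv σ) (inject₁ a)
  ... | no ¬p = ℕₚ.≮⇒≥ ¬p
  ... | yes p = contradiction
    (subst₂ F._<_ (inv-right σ perm (suc a)) (inv-right σ perm (inject₁ a))
      (cs p (trans (cong col (inv-right σ perm (suc a)))
        (trans (sym (block-uncut (cuts J) a eq)) (cong col (sym (inv-right σ perm (inject₁ a))))))))
    (ℕₚ.≤⇒≯ (subst (_≤ suc (toℕ a)) (sym (Fₚ.toℕ-inject₁ a)) (ℕₚ.n≤1+n _)))

  iDes⊑⇒columnSorted : ∀ σ → IsPerm σ → Des (inv σ) ⊑ J → ColumnSorted σ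
  iDes⊑⇒columnSorted σ perm h =
    ascends⇒columnSorted (inv σ) σ (inv-left σ perm) (Des⊑⇒ascends J (inv σ) h)

  columnSorted⇒iDes⊑ : ∀ σ → IsPerm σ → ColumnSorted σ → Des (inv σ) ⊑ J
  columnSorted⇒iDes⊑ σ perm cs = ascends⇒Des⊑ J (inv σ) (columnSorted⇒ascends σ perm cs)

  -- If the right entry were smaller, its column would be at most the left one, hence equal to it,
  -- and equal columns increase from left to right.
  columnSorted-≤ : ∀ σ → ColumnSorted σ → ∀ {i j} → i F.< j →
    col (lookup σ i) F.≤ col (lookup σ j) → lookup σ i F.≤ lookup σ j
  columnSorted-≤ σ cs {i} {j} i<j c≤c with lookup σ i F.≤? lookup σ j
  ... | yes p = p
  ... | no ¬p = contradiction
    (ℕₚ.<⇒≤ (cs i<j (Fₚ.toℕ-injective (ℕₚ.≤-antisym c≤c (block-mono (cuts J) (ℕₚ.<⇒≤ (ℕₚ.≰⇒> ¬p))))))) ¬p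

  -- Rules out one sign at the first disagreement i. The value σ(i) occurs in τ, but not before i,
  -- where the permutations agree, and not after i, where it would be a smaller entry of the column
  -- of τ(i).
  columnSorted-unique-≮ : ∀ σ τ → IsPerm σ → IsPerm τ → ColumnSorted τ →
    (∀ i → col (lookup σ i) ≡ col (lookup τ i)) →
    ∀ i → (∀ j → j F.< i → lookup σ j ≡ lookup τ j) → ¬ lookup σ i F.< lookup τ i
  columnSorted-unique-≮ σ τ σperm τperm τcs same i ih σi<τi
    with j , τj≡σi ← injective⇒surjective {f = lookup τ} (λ {a} {b} → τperm a b) (lookup σ i)
    with Fₚ.<-cmp j i
  ... | tri< j<i _ _ = Fₚ.<-irrefl (σperm _ _ (trans (ih j j<i) τj≡σi)) j<i
  ... | tri≈ _ refl _ = Fₚ.<-irrefl (sym τj≡σi) σi<τi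
  ... | tri> _ _ i<j = ℕₚ.<-asym σi<τi (subst (lookup τ i F.<_) τj≡σi
    (τcs i<j (trans (sym (same i)) (cong col (sym τj≡σi)))))

  columnSorted-unique : ∀ σ τ → IsPerm σ → IsPerm τ → ColumnSorted σ → ColumnSorted τ →
    (∀ i → col (lookup σ i) ≡ col (lookup τ i)) → σ ≡ τ
  columnSorted-unique σ τ σperm τperm σcs τcs same = lookup-ext λ i → go i (<-wellFounded i)
    where
    go : ∀ i → Acc F._<_ i → lookup σ i ≡ lookup τ i
    go i (acc rec) with Fₚ.<-cmp (lookup σ i) (lookup τ i)
    ... | tri< lt _ _ = contradiction lt
      (columnSorted-unique-≮ σ τ σperm τperm τcs same i (λ j j<i → go j (rec j<i)))
    ... | tri≈ _ eq _ = eq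
    ... | tri> _ _ gt = contradiction gt
      (columnSorted-unique-≮ τ σ τperm σperm σcs (sym ∘ same) i (λ j j<i → sym (go j (rec j<i))))

  -- The word y has each letter c exactly as often as there are values in column c.
  Realizable : Vec (Fin n) n → Set
  Realizable y = ∃ λ (ι : Fin n → Fin n) → Injective _≡_ _≡_ ι × (∀ j → lookup y (ι j) ≡ col j)

  Realizable-swapAt : ∀ i y → Realizable y → Realizable (swapAt i y)
  Realizable-swapAt i y (ι , inj , h) = swapIndex i ∘ ι , inj ∘ swapIndex-injective i , λ j →
    trans (lookup-swapAt i y _) (trans (cong (lookup y) (swapIndex-involutive i (ι j))) (h j))

  Realizable-⟶* : ∀ {I y y′} → I ⊢ y ⟶* y′ → Realizable y → Realizable y′
  Realizable-⟶* = ⟶*-preserves Realizable λ i _ y → Realizable-swapAt i y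

  opaque
    -- The map ι assigns to each value a position carrying its letter, so it is already the inverse
    -- of a suitable permutation. Sorting its entries within the J-blocks of values makes this
    -- inverse ascend off J.
    realize : ∀ y → Realizable y →
      ∃ λ σ → IsPerm σ × ColumnSorted σ × (∀ i → col (lookup σ i) ≡ lookup y i)
    realize y (ι , inj , h) = inv ι′ , inv-perm ι′ perm′ ,
      ascends⇒columnSorted ι′ (inv ι′) (inv-right ι′ perm′) (sort-sorted key (cuts J) (λ _ _ _ → refl) ι₀) ,
      λ i → trans (sym (labels′ (lookup (inv ι′) i))) (cong (lookup y) (inv-right ι′ perm′ i))
      where
      key : Fin n → Fin n → ℕ
      key _ = toℕ
      ι₀ ι′ : Vec (Fin n) n
      ι₀ = tabulate ι
      ι′ = sort key (cuts J) ι₀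
      Good : Vec (Fin n) n → Set
      Good v = IsPerm v × (∀ j → lookup y (lookup v j) ≡ col j)
      good-swapAt : ∀ i → cuts J i ≡ false → ∀ v → Good v → Good (swapAt i v)
      good-swapAt i eq v (perm , labels) =
        (λ a b e → swapIndex-injective i (perm _ _ (trans (sym (lookup-swapAt i v a)) (trans e (lookup-swapAt i v b))))) ,
        λ j → trans (cong (lookup y) (lookup-swapAt i v j)) (trans (labels _) (block-swapIndex (cuts J) i eq j))
      good₀ : Good ι₀
      good₀ = (λ a b e → inj (trans (sym (lookup∘tabulate ι a)) (trans e (lookup∘tabulate ι b)))) ,
        λ j → trans (cong (lookup y) (lookup∘tabulate ι j)) (h j)
      good′ : Good ι′
      good′ = ⟶*-preserves Good good-swapAt (⟶*-sort key (cuts J) ι₀) good₀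
      perm′ : IsPerm ι′
      perm′ = proj₁ good′
      labels′ : ∀ j → lookup y (lookup ι′ j) ≡ col j
      labels′ = proj₂ good′

-- Cyclic rotations

next-inject₁ : ∀ {k} (i : Fin k) → next (inject₁ i) ≡ suc i
next-inject₁ zero    = refl
next-inject₁ (suc i) rewrite next-inject₁ i = refl

next-last : ∀ k → next (fromℕ k) ≡ zero
next-last zero    = refl
next-last (suc k) rewrite next-last k = refl

toℕ-next : ∀ {k} (i : Fin (suc k)) → toℕ i < k → toℕ (next i) ≡ suc (toℕ i)
toℕ-next {k} i i<k with view i
... | ‵fromℕ = contradiction (Fₚ.toℕ-fromℕ k) (ℕₚ.<⇒≢ i<k)
... | ‵inj₁ {i = j} _ = trans (cong toℕ (next-inject₁ j)) (cong suc (sym (Fₚ.toℕ-inject₁ j)))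

rot : ∀ {k} → ℕ → Fin (suc k) → Fin (suc k)
rot zero    a = a
rot (suc r) a = next (rot r a)

rot-+ : ∀ {k} r s (a : Fin (suc k)) → rot (r + s) a ≡ rot r (rot s a)
rot-+ zero    s a = refl
rot-+ (suc r) s a = cong next (rot-+ r s a)

rot-next : ∀ {k} r (a : Fin (suc k)) → rot r (next a) ≡ next (rot r a)
rot-next zero    a = refl
rot-next (suc r) a = cong next (rot-next r a)

lookup-∘ₚ : ∀ {n} (σ τ : Word n) i → lookup (σ ∘ₚ τ) i ≡ lookup σ (lookup τ i)
lookup-∘ₚ σ τ i = lookup∘tabulate (λ i → lookup σ (lookup τ i)) i

lookup-cycPow : ∀ {k} r (a : Fin (suc k)) → lookup (cycPow r) a ≡ rot r a
lookup-cycPow zero    a = lookup∘tabulate (λ i → i) a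
lookup-cycPow (suc r) a =
  trans (lookup-∘ₚ cyc (cycPow r) a) (trans (lookup∘tabulate next _) (cong next (lookup-cycPow r a)))

toℕ-rot-< : ∀ {k} r (a : Fin (suc k)) → r + toℕ a < suc k → toℕ (rot r a) ≡ r + toℕ a
toℕ-rot-< zero    a _ = refl
toℕ-rot-< {k} (suc r) a (s≤s r+a<k) with eq ← toℕ-rot-< r a (ℕₚ.m<n⇒m<1+n r+a<k) =
  trans (toℕ-next (rot r a) (subst (_< k) (sym eq) r+a<k)) (cong suc eq)

toℕ-rot-≥ : ∀ {k} r (a : Fin (suc k)) → suc k ≤ r + toℕ a → r + toℕ a < suc k + suc k →
  suc k + toℕ (rot r a) ≡ r + toℕ a
toℕ-rot-≥ zero a n≤a _ = contradiction (Fₚ.toℕ<n a) (ℕₚ.≤⇒≯ n≤a)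
toℕ-rot-≥ {k} (suc r) a (s≤s k≤r+a) (s≤s r+a<2n) with r + toℕ a ℕₚ.<? suc k
... | yes r+a<n = begin
  suc k + toℕ (next (rot r a))    ≡⟨ cong (λ b → suc k + toℕ (next b)) last ⟩
  suc k + toℕ (next (fromℕ k))    ≡⟨ cong (λ b → suc k + toℕ b) (next-last k) ⟩
  suc k + 0                       ≡⟨ ℕₚ.+-identityʳ (suc k) ⟩
  suc k                           ≡⟨ cong suc (ℕₚ.≤-antisym k≤r+a (ℕₚ.≤-pred r+a<n)) ⟩
  suc (r + toℕ a)                 ∎
  where
  open ≡-Reasoning
  last : rot r a ≡ fromℕ k
  last = Fₚ.toℕ-injective (trans (toℕ-rot-< r a r+a<n)
    (trans (ℕₚ.≤-antisym (ℕₚ.≤-pred r+a<n) k≤r+a) (sym (Fₚ.toℕ-fromℕ k))))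
... | no ¬r+a<n = begin
  suc k + toℕ (next (rot r a))    ≡⟨ cong (suc k +_) (toℕ-next (rot r a) small) ⟩
  suc k + suc (toℕ (rot r a))     ≡⟨ ℕₚ.+-suc (suc k) _ ⟩
  suc (suc k + toℕ (rot r a))     ≡⟨ cong suc ih ⟩
  suc (r + toℕ a)                 ∎
  where
  open ≡-Reasoning
  ih = toℕ-rot-≥ r a (ℕₚ.≮⇒≥ ¬r+a<n) (ℕₚ.m<n⇒m<1+n r+a<2n)
  small : toℕ (rot r a) < k
  small = ℕₚ.+-cancelˡ-< (suc k) _ _
    (subst₂ _<_ (sym ih) (ℕₚ.+-suc k k) r+a<2n)

rot-full : ∀ {k} (a : Fin (suc k)) → rot (suc k) a ≡ a
rot-full {k} a = Fₚ.toℕ-injective (ℕₚ.+-cancelˡ-≡ (suc k) _ _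
  (toℕ-rot-≥ (suc k) a (ℕₚ.m≤m+n (suc k) _) (ℕₚ.+-monoʳ-< (suc k) (Fₚ.toℕ<n a))))

-- The exponents k - v and p + 1 are chosen so that v goes to the last index and the last index goes
-- to p; the `suc` is the step from the last index to 0. For v = p they add up to the full turn
-- `suc k`.
toLast fromLast : ∀ {k} → Fin (suc k) → Fin (suc k) → Fin (suc k)
toLast v   = rot (toℕ (opposite v))
fromLast p = rot (suc (toℕ p))

toℕ-opposite-+ : ∀ {k} (v : Fin (suc k)) → toℕ (opposite v) + toℕ v ≡ k
toℕ-opposite-+ {k} v = trans (cong (_+ toℕ v) (Fₚ.opposite-prop v)) (ℕₚ.m∸n+n≡m (ℕₚ.≤-pred (Fₚ.toℕ<n v)))

fromLast-toLast : ∀ {k} (p a : Fin (suc k)) → fromLast p (toLast p a) ≡ a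
fromLast-toLast {k} p a = begin
  rot (suc (toℕ p)) (rot (toℕ (opposite p)) a) ≡⟨ rot-+ (suc (toℕ p)) _ a ⟨
  rot (suc (toℕ p + toℕ (opposite p))) a       ≡⟨ cong (λ r → rot (suc r) a)
                                                    (trans (ℕₚ.+-comm (toℕ p) _) (toℕ-opposite-+ p)) ⟩
  rot (suc k) a                                ≡⟨ rot-full a ⟩
  a                                            ∎
  where open ≡-Reasoning

toLast-fromLast : ∀ {k} (p a : Fin (suc k)) → toLast p (fromLast p a) ≡ a
toLast-fromLast {k} p a = begin
  rot (toℕ (opposite p)) (rot (suc (toℕ p)) a) ≡⟨ rot-+ (toℕ (opposite p)) _ a ⟨
  rot (toℕ (opposite p) + suc (toℕ p)) a       ≡⟨ cong (λ r → rot r a)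
                                                    (trans (ℕₚ.+-suc (toℕ (opposite p)) (toℕ p)) (cong suc (toℕ-opposite-+ p))) ⟩
  rot (suc k) a                                ≡⟨ rot-full a ⟩
  a                                            ∎
  where open ≡-Reasoning

toLast-injective : ∀ {k} (p : Fin (suc k)) → Injective _≡_ _≡_ (toLast p)
toLast-injective p {a} {b} eq =
  trans (sym (fromLast-toLast p a)) (trans (cong (fromLast p) eq) (fromLast-toLast p b))

fromLast-injective : ∀ {k} (p : Fin (suc k)) → Injective _≡_ _≡_ (fromLast p)
fromLast-injective p {a} {b} eq =
  trans (sym (toLast-fromLast p a)) (trans (cong (toLast p) eq) (toLast-fromLast p b))

-- Adding k - v does not wrap here; for v < a it wraps once and loses `suc k`. Both cases are stated
-- additively to avoid truncated subtraction.
toℕ-toLast-≤ : ∀ {k} {v a : Fin (suc k)} → a F.≤ v → toℕ (toLast v a) + toℕ v ≡ k + toℕ a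
toℕ-toLast-≤ {k} {v} {a} a≤v = begin
  toℕ (toLast v a) + toℕ v  ≡⟨ cong (_+ toℕ v) (toℕ-rot-< r a (s≤s (subst (r + toℕ a ≤_) r+v (ℕₚ.+-monoʳ-≤ r a≤v)))) ⟩
  r + toℕ a + toℕ v         ≡⟨ swap r (toℕ a) (toℕ v) ⟩
  r + toℕ v + toℕ a         ≡⟨ cong (_+ toℕ a) r+v ⟩
  k + toℕ a                 ∎
  where
  open ≡-Reasoning
  r = toℕ (opposite v)
  r+v = toℕ-opposite-+ v
  swap : ∀ x y z → x + y + z ≡ x + z + y
  swap = solve-∀

toℕ-toLast-> : ∀ {k} {v a : Fin (suc k)} → v F.< a → toℕ (toLast v a) + suc (toℕ v) ≡ toℕ a
toℕ-toLast-> {k} {v} {a} v<a = ℕₚ.+-cancelˡ-≡ k _ _ (begin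
  k + (toℕ (toLast v a) + suc (toℕ v)) ≡⟨ rearrange k (toℕ (toLast v a)) (toℕ v) ⟩
  suc k + toℕ (toLast v a) + toℕ v     ≡⟨ cong (_+ toℕ v) (toℕ-rot-≥ r a atLeast bound) ⟩
  r + toℕ a + toℕ v                    ≡⟨ swap r (toℕ a) (toℕ v) ⟩
  r + toℕ v + toℕ a                    ≡⟨ cong (_+ toℕ a) r+v ⟩
  k + toℕ a                            ∎)
  where
  open ≡-Reasoning
  r = toℕ (opposite v)
  r+v = toℕ-opposite-+ v
  atLeast : suc k ≤ r + toℕ a
  atLeast = subst (_≤ r + toℕ a) (trans (ℕₚ.+-suc r (toℕ v)) (cong suc r+v)) (ℕₚ.+-monoʳ-≤ r v<a)
  bound : r + toℕ a < suc k + suc k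
  bound = ℕₚ.+-mono-< (Fₚ.toℕ<n (opposite v)) (Fₚ.toℕ<n a)
  swap : ∀ x y z → x + y + z ≡ x + z + y
  swap = solve-∀
  rearrange : ∀ x y z → x + (y + suc z) ≡ suc x + y + z
  rearrange = solve-∀

toLast-self : ∀ {k} (v : Fin (suc k)) → toLast v v ≡ fromℕ k
toLast-self {k} v = Fₚ.toℕ-injective (trans
  (ℕₚ.+-cancelʳ-≡ (toℕ v) _ _ (toℕ-toLast-≤ {v = v} ℕₚ.≤-refl)) (sym (Fₚ.toℕ-fromℕ k)))

fromLast-last : ∀ {k} (p : Fin (suc k)) → fromLast p (fromℕ k) ≡ p
fromLast-last p = trans (cong (fromLast p) (sym (toLast-self p))) (fromLast-toLast p p)

toℕ-opposite-surjective : ∀ {k r} → r < suc k → ∃ λ v → r ≡ toℕ (opposite {suc k} v)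
toℕ-opposite-surjective r<n = opposite (F.fromℕ< r<n) ,
  sym (trans (cong toℕ (Fₚ.opposite-involutive _)) (Fₚ.toℕ-fromℕ< r<n))

transpose-left : ∀ {n} (i j : Fin n) → transpose i j i ≡ j
transpose-left i j rewrite dec-true (i F.≟ i) refl = refl

transpose-right : ∀ {n} (i j : Fin n) → transpose i j j ≡ i
transpose-right i j with j F.≟ i
... | yes j≡i = j≡i
... | no _ rewrite dec-true (j F.≟ j) refl = refl

transpose-other : ∀ {n} (i j k : Fin n) → k ≢ i → k ≢ j → transpose i j k ≡ k
transpose-other i j k k≢i k≢j rewrite dec-false (k F.≟ i) k≢i | dec-false (k F.≟ j) k≢j = refl

FixesLast : ∀ {k} → Word (suc k) → Set
FixesLast {k} σ = lookup σ (fromℕ k) ≡ fromℕ k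

opaque
  shift : ∀ {k} → Fin (suc k) → Word (suc k) → Word (suc k)
  shift p σ = tabulate λ i → toLast (lookup σ p) (lookup σ (fromLast p i))

  lookup-shift : ∀ {k} p (σ : Word (suc k)) i →
    lookup (shift p σ) i ≡ toLast (lookup σ p) (lookup σ (fromLast p i))
  lookup-shift p σ i = lookup∘tabulate (λ i → toLast (lookup σ p) (lookup σ (fromLast p i))) i

-- Descents of a shifted permutation, read off a word

module ShiftedWord {m : ℕ} (J I : Subset m) (p′ : Fin (suc m)) where

  open Columns J

  private
    n : ℕ
    n = suc (suc m)

    last p q : Fin n
    last = fromℕ (suc m)
    p    = inject₁ p′
    -- The place to which the rotation carries the last position: p + q = m, so p + 1 + q is the
    -- last index.
    q    = inject₁ (opposite p′)

  -- Reads σ cyclically from the place after p. The plain rotation would read n at q and the entry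
  -- at p last. The transposition exchanges the two: n stays last, the pivot entry fills the gap at
  -- q, and the word keeps the content of the unshifted one.
  pos pos⁻¹ : Fin n → Fin n
  pos i   = fromLast p (transpose q last i)
  pos⁻¹ i = transpose last q (toLast p i)

  pos-pos⁻¹ : ∀ i → pos (pos⁻¹ i) ≡ i
  pos-pos⁻¹ i = trans (cong (fromLast p) (transpose-inverse q last)) (fromLast-toLast p i)

  pos⁻¹-pos : ∀ i → pos⁻¹ (pos i) ≡ i
  pos⁻¹-pos i = trans (cong (transpose last q) (toLast-fromLast p _)) (transpose-inverse last q)

  open Pivot {ℓ = n} (cuts I) q

  opaque
    shiftedWord : Word n → Letters
    shiftedWord σ = tabulate λ i → col (lookup σ (pos i))

    lookup-shiftedWord : ∀ σ i → lookup (shiftedWord σ) i ≡ col (lookup σ (pos i))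
    lookup-shiftedWord σ i = lookup∘tabulate (λ i → col (lookup σ (pos i))) i

  q+p : toℕ q + toℕ p ≡ m
  q+p = trans (cong₂ _+_ (Fₚ.toℕ-inject₁ (opposite p′)) (Fₚ.toℕ-inject₁ p′)) (toℕ-opposite-+ p′)

  pos-q : pos q ≡ p
  pos-q = trans (cong (fromLast p) (transpose-left q last)) (fromLast-last p)

  fromLast-q : fromLast p q ≡ last
  fromLast-q = Fₚ.toℕ-injective (trans (toℕ-rot-< (suc (toℕ p)) q (s≤s (s≤s (ℕₚ.≤-reflexive sum))))
    (trans (cong suc sum) (sym (Fₚ.toℕ-fromℕ (suc m)))))
    where
    sum : toℕ p + toℕ q ≡ m
    sum = trans (ℕₚ.+-comm (toℕ p) _) q+p

  pos-last : pos last ≡ last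
  pos-last = trans (cong (fromLast p) (transpose-right q last)) fromLast-q

  pos-off : ∀ i → i ≢ q → i ≢ last → pos i ≡ fromLast p i
  pos-off i i≢q i≢last = cong (fromLast p) (transpose-other q last i i≢q i≢last)

  q<last : q F.< last
  q<last = subst (toℕ q <_) (sym (Fₚ.toℕ-fromℕ (suc m))) (s≤s (subst (toℕ q ≤_) q+p (ℕₚ.m≤m+n _ _)))

  toℕ-pos-before : ∀ i → i F.< q → toℕ (pos i) ≡ suc (toℕ p) + toℕ i
  toℕ-pos-before i i<q = trans
    (cong toℕ (pos-off i (λ eq → Fₚ.<-irrefl eq i<q) (λ eq → Fₚ.<-irrefl eq (ℕₚ.<-trans i<q q<last))))
    (toℕ-rot-< (suc (toℕ p)) i (s≤s (s≤s (ℕₚ.<⇒≤ (subst (toℕ p + toℕ i <_) (trans (ℕₚ.+-comm (toℕ p) _) q+p)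
      (ℕₚ.+-monoʳ-< (toℕ p) i<q))))))

  toℕ-pos-after : ∀ i → q F.< i → i ≢ last → n + toℕ (pos i) ≡ suc (toℕ p) + toℕ i
  toℕ-pos-after i q<i i≢last = trans
    (cong (λ j → n + toℕ j) (pos-off i (λ eq → Fₚ.<-irrefl (sym eq) q<i) i≢last))
    (toℕ-rot-≥ (suc (toℕ p)) i
      (s≤s (subst (_< toℕ p + toℕ i) (trans (ℕₚ.+-comm (toℕ p) _) q+p) (ℕₚ.+-monoʳ-< (toℕ p) q<i)))
      (ℕₚ.+-mono-≤-< (Fₚ.toℕ<n p) (Fₚ.toℕ<n i)))

  p<pos : ∀ i → i F.< q → p F.< pos i
  p<pos i i<q = subst (toℕ p <_) (sym (toℕ-pos-before i i<q)) (s≤s (ℕₚ.m≤m+n _ _))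

  pos<p : ∀ i → q F.< i → i ≢ last → pos i F.< p
  pos<p i q<i i≢last = ℕₚ.+-cancelˡ-< n _ _ (subst (_< n + toℕ p) (sym (toℕ-pos-after i q<i i≢last))
    (subst (suc (toℕ p) + toℕ i <_) (ℕₚ.+-comm (toℕ p) n)
      (subst (suc (toℕ p) + toℕ i <_) (sym (ℕₚ.+-suc (toℕ p) (suc m)))
        (s≤s (ℕₚ.+-monoʳ-< (toℕ p) i<last)))))
    where
    i<last : toℕ i < suc m
    i<last = ℕₚ.≤∧≢⇒< (ℕₚ.≤-pred (Fₚ.toℕ<n i))
      λ eq → i≢last (Fₚ.toℕ-injective (trans eq (sym (Fₚ.toℕ-fromℕ (suc m)))))

  pos-mono-before : ∀ i j → i F.< j → j F.< q → pos i F.< pos j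
  pos-mono-before i j i<j j<q = subst₂ _<_ (sym (toℕ-pos-before i (ℕₚ.<-trans i<j j<q)))
    (sym (toℕ-pos-before j j<q)) (ℕₚ.+-monoʳ-< (suc (toℕ p)) i<j)

  pos-mono-after : ∀ i j → i F.< j → q F.< i → i ≢ last → j ≢ last → pos i F.< pos j
  pos-mono-after i j i<j q<i i≢last j≢last = ℕₚ.+-cancelˡ-< n _ _
    (subst₂ _<_ (sym (toℕ-pos-after i q<i i≢last)) (sym (toℕ-pos-after j (ℕₚ.<-trans q<i i<j) j≢last))
      (ℕₚ.+-monoʳ-< (suc (toℕ p)) i<j))

  module _ (σ : Word n) (perm : IsPerm σ) (fix : FixesLast σ) (cs : ColumnSorted σ) where

    private
      v x : Fin n
      v = lookup σ p
      x = col v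

      y : Letters
      y = shiftedWord σ

      letter : Fin n → Fin n
      letter i = lookup σ (pos i)

      v<last : v F.< last
      v<last = ℕₚ.≤∧≢⇒< (Fₚ.≤fromℕ v) λ eq → Fₚ.fromℕ≢inject₁
        (sym (perm p last (trans (Fₚ.toℕ-injective eq) (sym fix))))

      y-pivot : lookup y q ≡ x
      y-pivot = trans (lookup-shiftedWord σ q) (cong (col ∘ lookup σ) pos-q)

      key : Fin n → ℕ
      key i = rotatedAround (lookup y q) i (lookup y i)

      value : Fin n → ℕ
      value i = toℕ (lookup (shift p σ) i)

      -- The intended key, computed from the exact value: the values above v come first under
      -- `toLast v`. The word has to reproduce it from columns alone.
      rank : Fin n → ℕ
      rank a = raised (does (v F.<? a)) (col a)

      -- Only letters equal to x are in doubt. Positions before q read entries to the right of p,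
      -- where a value of column x exceeds v; positions after q read entries to the left of p, where
      -- it is below v.
      upperHalf-letter : ∀ i → i ≢ q → i ≢ last → upperHalf x i (col (letter i)) ≡ does (v F.<? letter i)
      upperHalf-letter i i≢q i≢last with Fₚ.<-cmp i q
      ... | tri≈ _ i≡q _ = contradiction i≡q i≢q
      ... | tri< i<q _ _ = trans (upperHalf-before x i _ i<q) eq
        where
        eq : does (x F.≤? col (letter i)) ≡ does (v F.<? letter i)
        eq = does-⇔ (mk⇔
          (λ x≤ → ℕₚ.≤∧≢⇒< (columnSorted-≤ σ cs (p<pos i i<q) x≤)
            λ e → Fₚ.<-irrefl (perm _ _ (Fₚ.toℕ-injective e)) (p<pos i i<q))
          (λ v<a → block-mono (cuts J) (ℕₚ.<⇒≤ v<a))) (x F.≤? col (letter i)) (v F.<? letter i)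
      ... | tri> _ _ q<i = trans (upperHalf-after x i _ (ℕₚ.<⇒≤ q<i)) eq
        where
        eq : does (x F.<? col (letter i)) ≡ does (v F.<? letter i)
        eq = does-⇔ (mk⇔
          (λ x<c → ℕₚ.≰⇒> λ a≤v → ℕₚ.<⇒≱ x<c (block-mono (cuts J) a≤v))
          (λ v<a → ℕₚ.≰⇒> λ c≤x → ℕₚ.<⇒≱ v<a (columnSorted-≤ σ cs (pos<p i q<i i≢last) c≤x)))
          (x F.<? col (letter i)) (v F.<? letter i)

      key-off : ∀ i → i ≢ q → i ≢ last → key i ≡ rank (letter i)
      key-off i i≢q i≢last = begin
        rotatedAround (lookup y q) i (lookup y i)  ≡⟨ rotatedAround-off _ i _ i≢q ⟩
        rotated (lookup y q) i (lookup y i)        ≡⟨ cong₂ (λ b c → rotated b i c) y-pivot (lookup-shiftedWord σ i) ⟩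
        rotated x i (col (letter i))               ≡⟨ cong (λ b → raised b (col (letter i))) (upperHalf-letter i i≢q i≢last) ⟩
        rank (letter i)                            ∎
        where open ≡-Reasoning

      key-pivot : key q ≡ n
      key-pivot = rotatedAround-pivot _ _

      value-off : ∀ i → i ≢ q → i ≢ last → value i ≡ toℕ (toLast v (letter i))
      value-off i i≢q i≢last = cong toℕ (trans (lookup-shift p σ i)
        (cong (toLast v ∘ lookup σ) (sym (pos-off i i≢q i≢last))))

      value-pivot : value q ≡ toℕ (toLast v last)
      value-pivot = cong toℕ (trans (lookup-shift p σ q)
        (cong (toLast v) (trans (cong (lookup σ) fromLast-q) fix)))

      letter≢last : ∀ i → i ≢ last → letter i ≢ last
      letter≢last i i≢last eq = i≢last (trans (sym (pos⁻¹-pos i))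
        (trans (cong pos⁻¹ (perm _ _ (trans eq (sym fix)))) (trans (cong pos⁻¹ (sym pos-last)) (pos⁻¹-pos last))))

      rank-> : ∀ {a} → v F.< a → rank a ≡ toℕ (col a)
      rank-> {a} v<a = cong (λ b → raised b (col a)) (dec-true (v F.<? a) v<a)

      rank-≤ : ∀ {a} → a F.≤ v → rank a ≡ n + n + toℕ (col a)
      rank-≤ {a} a≤v = cong (λ b → raised b (col a)) (dec-false (v F.<? a) (ℕₚ.≤⇒≯ a≤v))

      toLast-wrap : ∀ {a b} → v F.< a → b F.≤ v → toLast v a F.< toLast v b
      toLast-wrap {a} {b} v<a b≤v = ℕₚ.+-cancelʳ-≤ (toℕ v) _ _ (begin
        suc (toℕ (toLast v a)) + toℕ v    ≡⟨ ℕₚ.+-suc (toℕ (toLast v a)) (toℕ v) ⟨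
        toℕ (toLast v a) + suc (toℕ v)    ≡⟨ toℕ-toLast-> v<a ⟩
        toℕ a                             ≤⟨ ℕₚ.≤-pred (Fₚ.toℕ<n a) ⟩
        suc m                             ≤⟨ ℕₚ.m≤m+n (suc m) _ ⟩
        suc m + toℕ b                     ≡⟨ toℕ-toLast-≤ b≤v ⟨
        toℕ (toLast v b) + toℕ v          ∎)
        where open ℕₚ.≤-Reasoning

      rank-wrap : ∀ {a b} → v F.< a → b F.≤ v → rank a < rank b
      rank-wrap {a} {b} v<a b≤v = subst₂ _<_ (sym (rank-> v<a)) (sym (rank-≤ b≤v))
        (ℕₚ.<-≤-trans (Fₚ.toℕ<n (col a)) (ℕₚ.≤-trans (ℕₚ.m≤m+n n n) (ℕₚ.m≤m+n (n + n) _)))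

      both : ∀ {A B : Set} → A → B → A ⇔ B
      both a b = mk⇔ (λ _ → b) (λ _ → a)

      neither : ∀ {A B : Set} → ¬ A → ¬ B → A ⇔ B
      neither ¬a ¬b = mk⇔ (λ a → contradiction a ¬a) (λ b → contradiction b ¬b)

      -- `toLast v` puts the values above v in front of the others and keeps the order inside each
      -- half. Inside a half, comparing values at i < j amounts to comparing columns; across the
      -- halves both comparisons are decided the same way.
      compare : ∀ {i j} → i F.< j → toLast v (lookup σ i) F.≤ toLast v (lookup σ j) ⇔
        rank (lookup σ i) ≤ rank (lookup σ j)
      compare {i} {j} i<j = go (v F.<? a) (v F.<? b)
        where
        a = lookup σ i
        b = lookup σ j
        go : Dec (v F.< a) → Dec (v F.< b) → toLast v a F.≤ toLast v b ⇔ rank a ≤ rank b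
        go (yes v<a) (yes v<b) = mk⇔
          (λ h → subst₂ _≤_ (sym (rank-> v<a)) (sym (rank-> v<b)) (block-mono (cuts J)
            (subst₂ _≤_ (toℕ-toLast-> v<a) (toℕ-toLast-> v<b) (ℕₚ.+-monoˡ-≤ (suc (toℕ v)) h))))
          (λ h → ℕₚ.+-cancelʳ-≤ (suc (toℕ v)) _ _
            (subst₂ _≤_ (sym (toℕ-toLast-> v<a)) (sym (toℕ-toLast-> v<b))
              (columnSorted-≤ σ cs i<j (subst₂ _≤_ (rank-> v<a) (rank-> v<b) h))))
        go (yes v<a) (no v≮b) =
          both (ℕₚ.<⇒≤ (toLast-wrap v<a (ℕₚ.≮⇒≥ v≮b))) (ℕₚ.<⇒≤ (rank-wrap v<a (ℕₚ.≮⇒≥ v≮b)))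
        go (no v≮a) (yes v<b) =
          neither (ℕₚ.<⇒≱ (toLast-wrap v<b (ℕₚ.≮⇒≥ v≮a))) (ℕₚ.<⇒≱ (rank-wrap v<b (ℕₚ.≮⇒≥ v≮a)))
        go (no v≮a) (no v≮b) = mk⇔
          (λ h → subst₂ _≤_ (sym (rank-≤ a≤v)) (sym (rank-≤ b≤v)) (ℕₚ.+-monoʳ-≤ (n + n) (block-mono (cuts J)
            (ℕₚ.+-cancelˡ-≤ (suc m) _ _
              (subst₂ _≤_ (toℕ-toLast-≤ a≤v) (toℕ-toLast-≤ b≤v) (ℕₚ.+-monoˡ-≤ (toℕ v) h))))))
          (λ h → ℕₚ.+-cancelʳ-≤ (toℕ v) _ _
            (subst₂ _≤_ (sym (toℕ-toLast-≤ a≤v)) (sym (toℕ-toLast-≤ b≤v)) (ℕₚ.+-monoʳ-≤ (suc m)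
              (columnSorted-≤ σ cs i<j (ℕₚ.+-cancelˡ-≤ (n + n) _ _ (subst₂ _≤_ (rank-≤ a≤v) (rank-≤ b≤v) h))))))
          where
          a≤v = ℕₚ.≮⇒≥ v≮a
          b≤v = ℕₚ.≮⇒≥ v≮b

      -- At q stands the image of n, the largest value above v, so it ends the front half, just as
      -- the key n separates the ranks of the two halves.
      compare-to-pivot : ∀ a → toLast v a F.≤ toLast v last ⇔ rank a ≤ n
      compare-to-pivot a with v F.<? a
      ... | yes v<a = both
        (ℕₚ.+-cancelʳ-≤ (suc (toℕ v)) _ _ (subst₂ _≤_ (sym (toℕ-toLast-> v<a)) (sym (toℕ-toLast-> v<last)) (Fₚ.≤fromℕ a)))
        (subst (_≤ n) (sym (rank-> v<a)) (ℕₚ.<⇒≤ (Fₚ.toℕ<n (col a))))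
      ... | no v≮a = neither (ℕₚ.<⇒≱ (toLast-wrap v<last (ℕₚ.≮⇒≥ v≮a)))
        λ h → contradiction (raised-below false (subst (_≤ n) (rank-≤ (ℕₚ.≮⇒≥ v≮a)) h)) λ ()

      compare-from-pivot : ∀ a → a ≢ last → toLast v last F.≤ toLast v a ⇔ n ≤ rank a
      compare-from-pivot a a≢last with v F.<? a
      ... | yes v<a = neither
        (λ h → a≢last (Fₚ.toℕ-injective (ℕₚ.≤-antisym (Fₚ.≤fromℕ a)
          (subst₂ _≤_ (toℕ-toLast-> v<last) (toℕ-toLast-> v<a) (ℕₚ.+-monoˡ-≤ (suc (toℕ v)) h)))))
        (λ h → contradiction (raised-above true (subst (n ≤_) (rank-> v<a) h)) λ ())
      ... | no v≮a = both (ℕₚ.<⇒≤ (toLast-wrap v<last (ℕₚ.≮⇒≥ v≮a)))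
        (subst (n ≤_) (sym (rank-≤ (ℕₚ.≮⇒≥ v≮a))) (ℕₚ.≤-trans (ℕₚ.m≤m+n n n) (ℕₚ.m≤m+n (n + n) _)))

      transport : ∀ {a b c d a′ b′ c′ d′ : ℕ} → a′ ≡ a → b′ ≡ b → c′ ≡ c → d′ ≡ d →
        (a ≤ b ⇔ c ≤ d) → (a′ ≤ b′ ⇔ c′ ≤ d′)
      transport refl refl refl refl h = h

      compare-step : ∀ i → suc i ≢ last → value (inject₁ i) ≤ value (suc i) ⇔ key (inject₁ i) ≤ key (suc i)
      compare-step i si≢last = go (inject₁ i F.≟ q) (suc i F.≟ q)
        where
        i<si : inject₁ i F.< suc i
        i<si = inject₁<suc i
        i≢last : inject₁ i ≢ last
        i≢last = Fₚ.fromℕ≢inject₁ ∘ sym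
        go : Dec (inject₁ i ≡ q) → Dec (suc i ≡ q) → value (inject₁ i) ≤ value (suc i) ⇔ key (inject₁ i) ≤ key (suc i)
        go (yes i≡q) (yes si≡q) = contradiction i<si (Fₚ.<-irrefl (trans i≡q (sym si≡q)))
        go (yes i≡q) (no si≢q) = transport (trans (cong value i≡q) value-pivot) (value-off (suc i) si≢q si≢last)
          (trans (cong key i≡q) key-pivot) (key-off (suc i) si≢q si≢last)
          (compare-from-pivot (letter (suc i)) (letter≢last (suc i) si≢last))
        go (no i≢q) (yes si≡q) = transport (value-off (inject₁ i) i≢q i≢last) (trans (cong value si≡q) value-pivot)
          (key-off (inject₁ i) i≢q i≢last) (trans (cong key si≡q) key-pivot)
          (compare-to-pivot (letter (inject₁ i)))
        go (no i≢q) (no si≢q) = transport (value-off (inject₁ i) i≢q i≢last) (value-off (suc i) si≢q si≢last)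
          (key-off (inject₁ i) i≢q i≢last) (key-off (suc i) si≢q si≢last) (compare ordered)
          where
          -- Neither of the neighbours is q, so they lie on the same side of q, where `pos`
          -- preserves the order.
          ordered : pos (inject₁ i) F.< pos (suc i)
          ordered with Fₚ.<-cmp (suc i) q
          ... | tri< si<q _ _ = pos-mono-before (inject₁ i) (suc i) i<si si<q
          ... | tri≈ _ si≡q _ = contradiction si≡q si≢q
          ... | tri> _ _ q<si = pos-mono-after (inject₁ i) (suc i) i<si (step-after i i≢q q<si) i≢last si≢last

      uncut≢last : ∀ i → cuts I i ≡ false → suc i ≢ last
      uncut≢last i eq si≡last = contradiction
        (trans (sym (cuts-last I)) (trans (cong (cuts I) (sym (Fₚ.suc-injective si≡last))) eq)) λ ()

    shift-ascends⇒rotatedSorted : AscendsOff I (lookup (shift p σ)) → RotatedSorted (shiftedWord σ)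
    shift-ascends⇒rotatedSorted h i eq = Equivalence.to (compare-step i (uncut≢last i eq)) (h i eq)

    rotatedSorted⇒shift-ascends : RotatedSorted (shiftedWord σ) → AscendsOff I (lookup (shift p σ))
    rotatedSorted⇒shift-ascends h i eq = Equivalence.from (compare-step i (uncut≢last i eq)) (h i eq)

-- Matching plain and shifted permutations through their words

module Correspondence {m : ℕ} (J I : Subset m) (p′ : Fin (suc m)) where

  open Columns J
  open ShiftedWord J I p′

  private
    n : ℕ
    n = suc (suc m)

    last p q : Fin n
    last = fromℕ (suc m)
    p    = inject₁ p′
    q    = inject₁ (opposite p′)

  open Pivot {ℓ = n} (cuts I) q

  opaque
    plainWord : Word n → Letters
    plainWord σ = tabulate λ i → col (lookup σ i)

    lookup-plainWord : ∀ σ i → lookup (plainWord σ) i ≡ col (lookup σ i)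
    lookup-plainWord σ i = lookup∘tabulate (λ i → col (lookup σ i)) i

  swapAt-last : ∀ i → cuts I i ≡ false → ∀ (u : Letters) → lookup (swapAt i u) last ≡ lookup u last
  swapAt-last i eq u with swapView i last
  ... | lower e _ = contradiction e Fₚ.fromℕ≢inject₁
  ... | upper e _ = contradiction
    (trans (sym (cuts-last I)) (trans (cong (cuts I) (Fₚ.suc-injective e)) eq)) λ ()
  ... | other e = trans (lookup-swapAt i u last) (cong (lookup u) e)

  ⟶*-last : ∀ {u v} → cuts I ⊢ u ⟶* v → lookup v last ≡ lookup u last
  ⟶*-last {u} s = ⟶*-preserves (λ v → lookup v last ≡ lookup u last)
    (λ i eq v e → trans (swapAt-last i eq v) e) s refl

  Plain Shifted : Word n → Set
  Plain σ   = IsPerm σ × FixesLast σ × Des (inv σ) ⊑ J × Des σ ⊑ I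
  Shifted σ = IsPerm σ × FixesLast σ × Des (inv σ) ⊑ J × Des (shift p σ) ⊑ I

  plain-sorted : ∀ σ → AscendsOff I (lookup σ) → Sorted ascending (cuts I) (plainWord σ)
  plain-sorted σ asc i eq = subst₂ F._≤_ (sym (lookup-plainWord σ _)) (sym (lookup-plainWord σ _))
    (block-mono (cuts J) (asc i eq))

  sorted-plain : ∀ σ → ColumnSorted σ → Sorted ascending (cuts I) (plainWord σ) → AscendsOff I (lookup σ)
  sorted-plain σ cs s i eq = columnSorted-≤ σ cs
    (inject₁<suc i)
    (subst₂ F._≤_ (lookup-plainWord σ _) (lookup-plainWord σ _) (s i eq))

  plain-realizable : ∀ σ → IsPerm σ → Realizable (plainWord σ)
  plain-realizable σ perm = lookup (inv σ) , (λ {a} {b} → inv-perm σ perm a b) ,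
    λ j → trans (lookup-plainWord σ _) (cong col (inv-right σ perm j))

  shifted-realizable : ∀ σ → IsPerm σ → Realizable (shiftedWord σ)
  shifted-realizable σ perm = pos⁻¹ ∘ lookup (inv σ) ,
    (λ {a} {b} eq → inv-perm σ perm a b
      (trans (sym (pos-pos⁻¹ _)) (trans (cong pos eq) (pos-pos⁻¹ _)))) ,
    λ j → trans (lookup-shiftedWord σ _) (trans (cong (col ∘ lookup σ) (pos-pos⁻¹ _)) (cong col (inv-right σ perm j)))

  realize-plain : ∀ y → Realizable y → lookup y last ≡ col last →
    ∃ λ σ → IsPerm σ × FixesLast σ × ColumnSorted σ × plainWord σ ≡ y
  realize-plain y r y-last =
    let σ , perm , cs , h = realize y r in
    σ , perm , block-last J _ (trans (h last) y-last) , cs ,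
    lookup-ext λ i → trans (lookup-plainWord σ i) (h i)

  -- The letters are carried back along `pos⁻¹` before realizing, since `realize` expects them at
  -- the positions of σ itself.
  realize-shifted : ∀ y → Realizable y → lookup y last ≡ col last →
    ∃ λ σ → IsPerm σ × FixesLast σ × ColumnSorted σ × shiftedWord σ ≡ y
  realize-shifted y (ι , inj , r) y-last =
    σ , perm , block-last J _ (trans (cong (col ∘ lookup σ) (sym pos-last)) (trans (letters last) y-last)) , cs ,
    lookup-ext λ i → trans (lookup-shiftedWord σ i) (letters i)
    where
    u : Letters
    u = tabulate (lookup y ∘ pos⁻¹)
    realizable : Realizable u
    realizable = pos ∘ ι ,
      (λ {a} {b} eq → inj (trans (sym (pos⁻¹-pos (ι a))) (trans (cong pos⁻¹ eq) (pos⁻¹-pos (ι b))))) ,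
      λ j → trans (lookup∘tabulate (lookup y ∘ pos⁻¹) (pos (ι j))) (trans (cong (lookup y) (pos⁻¹-pos (ι j))) (r j))
    σ = proj₁ (realize u realizable)
    perm = proj₁ (proj₂ (realize u realizable))
    cs : ColumnSorted σ
    cs = proj₁ (proj₂ (proj₂ (realize u realizable)))
    letters : ∀ i → col (lookup σ (pos i)) ≡ lookup y i
    letters i = trans (proj₂ (proj₂ (proj₂ (realize u realizable))) (pos i))
      (trans (lookup∘tabulate (lookup y ∘ pos⁻¹) (pos i)) (cong (lookup y) (pos⁻¹-pos i)))

  plain⇒shifted : ∀ σ → Plain σ → ∃ λ τ → Shifted τ × shiftedWord τ ≡ pivotSort (plainWord σ)
  plain⇒shifted σ (perm , fix , iDes⊑ , _) =
    let τ , τperm , τfix , τcs , eq = realize-shifted (pivotSort (plainWord σ))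
          (Realizable-⟶* (⟶*-pivotSort (plainWord σ)) (plain-realizable σ perm))
          (trans (⟶*-last (⟶*-pivotSort (plainWord σ))) (trans (lookup-plainWord σ last) (cong col fix))) in
    τ , (τperm , τfix , columnSorted⇒iDes⊑ τ τperm τcs ,
      ascends⇒Des⊑ I (shift p τ) (rotatedSorted⇒shift-ascends τ τperm τfix τcs
        (subst RotatedSorted (sym eq) (pivotSort-sorted (plainWord σ))))) , eq

  shifted⇒plain : ∀ σ → Shifted σ → ∃ λ τ → Plain τ × plainWord τ ≡ plainSort (shiftedWord σ)
  shifted⇒plain σ (perm , fix , iDes⊑ , _) =
    let τ , τperm , τfix , τcs , eq = realize-plain (plainSort (shiftedWord σ))
          (Realizable-⟶* (⟶*-plainSort (shiftedWord σ)) (shifted-realizable σ perm))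
          (trans (⟶*-last (⟶*-plainSort (shiftedWord σ)))
            (trans (lookup-shiftedWord σ last) (cong col (trans (cong (lookup σ) pos-last) fix)))) in
    τ , (τperm , τfix , columnSorted⇒iDes⊑ τ τperm τcs ,
      ascends⇒Des⊑ I τ (sorted-plain τ τcs
        (subst (Sorted ascending (cuts I)) (sym eq) (plainSort-sorted (shiftedWord σ))))) , eq

  plainWord-injective : ∀ σ τ → Plain σ → Plain τ → plainWord σ ≡ plainWord τ → σ ≡ τ
  plainWord-injective σ τ (perm , _ , h , _) (perm′ , _ , h′ , _) eq =
    columnSorted-unique σ τ perm perm′ (iDes⊑⇒columnSorted σ perm h) (iDes⊑⇒columnSorted τ perm′ h′)
      λ i → trans (sym (lookup-plainWord σ i)) (trans (cong (λ u → lookup u i) eq) (lookup-plainWord τ i))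

  shiftedWord-injective : ∀ σ τ → Shifted σ → Shifted τ → shiftedWord σ ≡ shiftedWord τ → σ ≡ τ
  shiftedWord-injective σ τ (perm , _ , h , _) (perm′ , _ , h′ , _) eq =
    columnSorted-unique σ τ perm perm′ (iDes⊑⇒columnSorted σ perm h) (iDes⊑⇒columnSorted τ perm′ h′) same
    where
    same′ : ∀ i → col (lookup σ (pos i)) ≡ col (lookup τ (pos i))
    same′ i = trans (sym (lookup-shiftedWord σ i)) (trans (cong (λ u → lookup u i) eq) (lookup-shiftedWord τ i))
    same : ∀ i → col (lookup σ i) ≡ col (lookup τ i)
    same i = subst (λ j → col (lookup σ j) ≡ col (lookup τ j)) (pos-pos⁻¹ i) (same′ (pos⁻¹ i))

  pivotSort-injective : ∀ σ τ → Plain σ → Plain τ →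
    pivotSort (plainWord σ) ≡ pivotSort (plainWord τ) → σ ≡ τ
  pivotSort-injective σ τ Pσ Pτ eq = plainWord-injective σ τ Pσ Pτ (trans (sym (restore σ Pσ))
    (trans (cong plainSort eq) (restore τ Pτ)))
    where
    restore : ∀ σ → Plain σ → plainSort (pivotSort (plainWord σ)) ≡ plainWord σ
    restore σ (_ , _ , _ , h) = plainSort-pivotSort _ (plain-sorted σ (Des⊑⇒ascends I σ h))

  plainSort-injective : ∀ σ τ → Shifted σ → Shifted τ →
    plainSort (shiftedWord σ) ≡ plainSort (shiftedWord τ) → σ ≡ τ
  plainSort-injective σ τ Sσ Sτ eq = shiftedWord-injective σ τ Sσ Sτ (trans (sym (restore σ Sσ))
    (trans (cong pivotSort eq) (restore τ Sτ)))
    where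
    restore : ∀ σ → Shifted σ → pivotSort (plainSort (shiftedWord σ)) ≡ shiftedWord σ
    restore σ (perm , fix , iDes⊑ , h) = pivotSort-plainSort _
      (shift-ascends⇒rotatedSorted σ perm fix (iDes⊑⇒columnSorted σ perm iDes⊑) (Des⊑⇒ascends I (shift p σ) h))

-- Möbius inversion for lists of subsets

-- A relation replaces the function because an image is constructed only from the properties of a
-- member. Injectivity allows the partner of the head to be deleted from `ys` without touching the
-- partners of the tail.
length-≤-injection : ∀ {A B : Set} (R : A → B → Set) xs ys → Unique xs →
  (∀ {x} → x ∈ xs → ∃ λ y → y ∈ ys × R x y) →
  (∀ {x x′ y} → x ∈ xs → x′ ∈ xs → R x y → R x′ y → x ≡ x′) →
  length xs ≤ length ys
length-≤-injection R [] ys _ _ _ = z≤n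
length-≤-injection R (x ∷ xs) ys (x∉xs ∷ unique) total inj
  with y , y∈ys , Rxy ← total (here refl)
  with as , bs , refl ← ∈-∃++ y∈ys =
  subst (suc (length xs) ≤_) (sym (Permₚ.↭-length (Permₚ.shift y as bs)))
    (s≤s (length-≤-injection R xs (as ++ bs) unique total′ λ p q → inj (there p) (there q)))
  where
  total′ : ∀ {x′} → x′ ∈ xs → ∃ λ y′ → y′ ∈ as ++ bs × R x′ y′
  total′ x′∈xs with y′ , y′∈ys , Rx′y′ ← total (there x′∈xs) with ∈-++⁻ as y′∈ys
  ... | inj₁ y′∈as         = y′ , ∈-++⁺ˡ y′∈as , Rx′y′
  ... | inj₂ (there y′∈bs) = y′ , ∈-++⁺ʳ as y′∈bs , Rx′y′
  ... | inj₂ (here refl)   = contradiction (inj (here refl) (there x′∈xs) Rxy Rx′y′) (All.lookup x∉xs x′∈xs)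

one : Bool → ℕ
one b = if b then 1 else 0

module _ {A : Set} where

  ♯ : ∀ {P : A → Set} → Decidable P → List A → ℕ
  ♯ P? xs = length (filter P? xs)

  ♯-∷ : ∀ {P : A → Set} (P? : Decidable P) x xs → ♯ P? (x ∷ xs) ≡ one (does (P? x)) + ♯ P? xs
  ♯-∷ P? x xs with does (P? x)
  ... | true  = refl
  ... | false = refl

  ♯-comm : ∀ {P Q : A → Set} (P? : Decidable P) (Q? : Decidable Q) xs →
    ♯ P? (filter Q? xs) ≡ ♯ Q? (filter P? xs)
  ♯-comm P? Q? [] = refl
  ♯-comm P? Q? (x ∷ xs) with does (P? x) in p | does (Q? x) in q
  ... | true  | true  rewrite p | q = cong suc (♯-comm P? Q? xs)
  ... | true  | false rewrite q = ♯-comm P? Q? xs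
  ... | false | true  rewrite p = ♯-comm P? Q? xs
  ... | false | false = ♯-comm P? Q? xs

  ♯-↭ : ∀ {P : A → Set} (P? : Decidable P) {xs ys} → xs ↭ ys → ♯ P? xs ≡ ♯ P? ys
  ♯-↭ P? p = Permₚ.↭-length (Permₚ.filter-↭ P? p)

  ♯-map : ∀ {B : Set} {P : A → Set} (P? : Decidable P) (f : B → A) xs →
    ♯ P? (map f xs) ≡ length (filter (P? ∘ f) xs)
  ♯-map P? f [] = refl
  ♯-map P? f (x ∷ xs) with does (P? (f x))
  ... | true  = cong suc (♯-map P? f xs)
  ... | false = ♯-map P? f xs

  module _ (_≟_ : DecidableEquality A) where

    ♯-≡⇒∈ : ∀ x ys {n} → ♯ (_≟ x) ys ≡ suc n → x ∈ ys
    ♯-≡⇒∈ x (y ∷ ys) eq with y ≟ x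
    ... | yes refl = here refl
    ... | no _     = there (♯-≡⇒∈ x ys eq)

    ♯-≡⇒↭ : ∀ xs ys → (∀ x → ♯ (_≟ x) xs ≡ ♯ (_≟ x) ys) → xs ↭ ys
    ♯-≡⇒↭ [] [] h = ↭-refl
    ♯-≡⇒↭ [] (y ∷ ys) h with () ← trans (h y)
      (trans (♯-∷ (_≟ y) y ys) (cong (λ b → one b + ♯ (_≟ y) ys) (dec-true (y ≟ y) refl)))
    ♯-≡⇒↭ (x ∷ xs) ys h
      with as , bs , refl ← ∈-∃++ (♯-≡⇒∈ x ys (trans (sym (h x))
        (trans (♯-∷ (_≟ x) x xs) (cong (λ b → one b + ♯ (_≟ x) xs) (dec-true (x ≟ x) refl))))) =
      ↭-trans (prep x (♯-≡⇒↭ xs (as ++ bs) rest)) (↭-sym (Permₚ.shift x as bs))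
      where
      rest : ∀ z → ♯ (_≟ z) xs ≡ ♯ (_≟ z) (as ++ bs)
      rest z = ℕₚ.+-cancelˡ-≡ (one (does (x ≟ z))) _ _ (begin
        one (does (x ≟ z)) + ♯ (_≟ z) xs          ≡⟨ ♯-∷ (_≟ z) x xs ⟨
        ♯ (_≟ z) (x ∷ xs)                    ≡⟨ h z ⟩
        ♯ (_≟ z) (as ++ x ∷ bs)              ≡⟨ ♯-↭ (_≟ z) (Permₚ.shift x as bs) ⟩
        ♯ (_≟ z) (x ∷ as ++ bs)              ≡⟨ ♯-∷ (_≟ z) x (as ++ bs) ⟩
        one (does (x ≟ z)) + ♯ (_≟ z) (as ++ bs)  ∎)
        where open ≡-Reasoning

_≟ₛ_ : ∀ {m} → DecidableEquality (Subset m)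
_≟ₛ_ = Vecₚ.≡-dec BoolP._≟_

_⊑?_ : ∀ {m} (I′ I : Subset m) → Dec (I′ ⊑ I)
I′ ⊑? I = Fₚ.all? λ i → (lookup I i BoolP.≟ false) →-dec (lookup I′ i BoolP.≟ false)

sumBelow : ∀ {m} → (Subset m → ℕ) → Subset m → ℕ
sumBelow f []          = f []
sumBelow f (false ∷ I) = sumBelow (f ∘ (false ∷_)) I
sumBelow f (true ∷ I)  = sumBelow (f ∘ (false ∷_)) I + sumBelow (f ∘ (true ∷_)) I

-- Möbius inversion one coordinate at a time: the sum below `true ∷ I` contains the sum below
-- `false ∷ I`, which already agrees and cancels.
sumBelow-injective : ∀ {m} (f g : Subset m → ℕ) → (∀ I → sumBelow f I ≡ sumBelow g I) → ∀ I → f I ≡ g I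
sumBelow-injective f g h [] = h []
sumBelow-injective f g h (false ∷ I) =
  sumBelow-injective (f ∘ (false ∷_)) (g ∘ (false ∷_)) (λ I → h (false ∷ I)) I
sumBelow-injective f g h (true ∷ I) =
  sumBelow-injective (f ∘ (true ∷_)) (g ∘ (true ∷_)) (λ I → ℕₚ.+-cancelˡ-≡ (sumBelow (f ∘ (false ∷_)) I) _ _
    (trans (h (true ∷ I)) (cong (_+ sumBelow (g ∘ (true ∷_)) I) (sym (h (false ∷ I)))))) I

sumBelow-cong : ∀ {m} {f g : Subset m → ℕ} → (∀ I → f I ≡ g I) → ∀ I → sumBelow f I ≡ sumBelow g I
sumBelow-cong h []          = h []
sumBelow-cong h (false ∷ I) = sumBelow-cong (h ∘ (false ∷_)) I
sumBelow-cong h (true ∷ I)  = cong₂ _+_ (sumBelow-cong (h ∘ (false ∷_)) I) (sumBelow-cong (h ∘ (true ∷_)) I)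

sumBelow-+ : ∀ {m} (f g : Subset m → ℕ) I → sumBelow (λ K → f K + g K) I ≡ sumBelow f I + sumBelow g I
sumBelow-+ f g []          = refl
sumBelow-+ f g (false ∷ I) = sumBelow-+ (f ∘ (false ∷_)) (g ∘ (false ∷_)) I
sumBelow-+ f g (true ∷ I)  = trans
  (cong₂ _+_ (sumBelow-+ (f ∘ (false ∷_)) (g ∘ (false ∷_)) I) (sumBelow-+ (f ∘ (true ∷_)) (g ∘ (true ∷_)) I))
  (+-interchange (sumBelow (f ∘ (false ∷_)) I) _ _ _)

sumBelow-0 : ∀ {m} (I : Subset m) → sumBelow (λ _ → 0) I ≡ 0
sumBelow-0 []          = refl
sumBelow-0 (false ∷ I) = sumBelow-0 I
sumBelow-0 (true ∷ I)  = cong₂ _+_ (sumBelow-0 I) (sumBelow-0 I)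

one-⇔ : ∀ {P Q : Set} → (P → Q) → (Q → P) → (P? : Dec P) (Q? : Dec Q) → one (does P?) ≡ one (does Q?)
one-⇔ to from P? Q? = cong one (does-⇔ (mk⇔ to from) P? Q?)

one-⊑ : ∀ {m} (K I : Subset m) → one (does (K ⊑? I)) ≡ sumBelow (λ K′ → one (does (K ≟ₛ K′))) I
one-⊑ [] [] = refl
one-⊑ (true ∷ K) (false ∷ I) = trans
  (cong one (dec-false ((true ∷ K) ⊑? (false ∷ I)) λ h → contradiction (h zero refl) λ ()))
  (sym (sumBelow-0 I))
one-⊑ (false ∷ K) (false ∷ I) = begin
  one (does ((false ∷ K) ⊑? (false ∷ I)))
    ≡⟨ one-⇔ (λ h i → h (suc i)) (λ { h zero _ → refl ; h (suc i) → h i }) ((false ∷ K) ⊑? (false ∷ I)) (K ⊑? I) ⟩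
  one (does (K ⊑? I))                          ≡⟨ one-⊑ K I ⟩
  sumBelow (λ K′ → one (does (K ≟ₛ K′))) I      ∎
  where open ≡-Reasoning
one-⊑ (b ∷ K) (true ∷ I) = begin
  one (does ((b ∷ K) ⊑? (true ∷ I)))
    ≡⟨ one-⇔ (λ h i → h (suc i)) (λ { h (suc i) → h i }) ((b ∷ K) ⊑? (true ∷ I)) (K ⊑? I) ⟩
  one (does (K ⊑? I))                          ≡⟨ one-⊑ K I ⟩
  sumBelow (λ K′ → one (does (K ≟ₛ K′))) I      ≡⟨ split b ⟩
  sumBelow (λ K′ → one (does ((b ∷ K) ≟ₛ (false ∷ K′)))) I +
  sumBelow (λ K′ → one (does ((b ∷ K) ≟ₛ (true ∷ K′)))) I ∎
  where
  open ≡-Reasoning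
  split : ∀ b → sumBelow (λ K′ → one (does (K ≟ₛ K′))) I ≡
    sumBelow (λ K′ → one (does ((b ∷ K) ≟ₛ (false ∷ K′)))) I + sumBelow (λ K′ → one (does ((b ∷ K) ≟ₛ (true ∷ K′)))) I
  split false = trans (sym (ℕₚ.+-identityʳ _)) (cong (sumBelow _ I +_) (sym (sumBelow-0 I)))
  split true  = cong (_+ sumBelow _ I) (sym (sumBelow-0 I))

♯-⊑ : ∀ {m} (xs : List (Subset m)) I → ♯ (_⊑? I) xs ≡ sumBelow (λ K → ♯ (_≟ₛ K) xs) I
♯-⊑ [] I = sym (sumBelow-0 I)
♯-⊑ (x ∷ xs) I = begin
  ♯ (_⊑? I) (x ∷ xs)                                ≡⟨ ♯-∷ (_⊑? I) x xs ⟩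
  one (does (x ⊑? I)) + ♯ (_⊑? I) xs                ≡⟨ cong₂ _+_ (one-⊑ x I) (♯-⊑ xs I) ⟩
  sumBelow (λ K → one (does (x ≟ₛ K))) I + sumBelow (λ K → ♯ (_≟ₛ K) xs) I ≡⟨ sumBelow-+ _ _ I ⟨
  sumBelow (λ K → one (does (x ≟ₛ K)) + ♯ (_≟ₛ K) xs) I ≡⟨ sumBelow-cong (λ K → ♯-∷ (_≟ₛ K) x xs) I ⟨
  sumBelow (λ K → ♯ (_≟ₛ K) (x ∷ xs)) I             ∎
  where open ≡-Reasoning

♯-⊑⇒↭ : ∀ {m} (xs ys : List (Subset m)) → (∀ I → ♯ (_⊑? I) xs ≡ ♯ (_⊑? I) ys) → xs ↭ ys
♯-⊑⇒↭ xs ys h = ♯-≡⇒↭ _≟ₛ_ xs ys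
  (sumBelow-injective _ _ λ I → trans (sym (♯-⊑ xs I)) (trans (h I) (♯-⊑ ys I)))

-- Inverts one variable at a time. For a fixed bound on g, inversion in I gives `inner`; counting
-- the same elements in the other order makes the exact value of f the fixed datum, and inversion in
-- J gives `outer`.
joint-↭ : ∀ {A : Set} {l m} (g : A → Subset l) (f f′ : A → Subset m) xs →
  (∀ J I → ♯ (λ a → f a ⊑? I) (filter (λ a → g a ⊑? J) xs) ≡ ♯ (λ a → f′ a ⊑? I) (filter (λ a → g a ⊑? J) xs)) →
  ∀ J → map f (filter (λ a → g a ≟ₛ J) xs) ↭ map f′ (filter (λ a → g a ≟ₛ J) xs)
joint-↭ g f f′ xs h J = ♯-≡⇒↭ _≟ₛ_ _ _ λ I → begin
  ♯ (_≟ₛ I) (map f (filter (λ a → g a ≟ₛ J) xs))    ≡⟨ exchange f (_≟ₛ J) I ⟨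
  ♯ (_≟ₛ J) (map g (filter (λ a → f a ≟ₛ I) xs))    ≡⟨ ♯-↭ (_≟ₛ J) (outer I) ⟩
  ♯ (_≟ₛ J) (map g (filter (λ a → f′ a ≟ₛ I) xs))   ≡⟨ exchange f′ (_≟ₛ J) I ⟩
  ♯ (_≟ₛ I) (map f′ (filter (λ a → g a ≟ₛ J) xs))   ∎
  where
  open ≡-Reasoning
  below : Subset _ → List _
  below J = filter (λ a → g a ⊑? J) xs
  inner : ∀ J → map f (filter (λ a → g a ⊑? J) xs) ↭ map f′ (filter (λ a → g a ⊑? J) xs)
  inner J = ♯-⊑⇒↭ _ _ λ I → trans (♯-map (_⊑? I) f (below J)) (trans (h J I) (sym (♯-map (_⊑? I) f′ (below J))))
  exchange : ∀ f {P} (P? : Decidable P) I →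
    ♯ P? (map g (filter (λ a → f a ≟ₛ I) xs)) ≡ ♯ (_≟ₛ I) (map f (filter (λ a → P? (g a)) xs))
  exchange f P? I = trans (♯-map P? g (filter (λ a → f a ≟ₛ I) xs))
    (trans (♯-comm (λ a → P? (g a)) (λ a → f a ≟ₛ I) xs) (sym (♯-map (_≟ₛ I) f (filter (λ a → P? (g a)) xs))))
  outer : ∀ I → map g (filter (λ a → f a ≟ₛ I) xs) ↭ map g (filter (λ a → f′ a ≟ₛ I) xs)
  outer I = ♯-⊑⇒↭ _ _ λ J →
    trans (exchange f (_⊑? J) I) (trans (♯-↭ (_≟ₛ I) (inner J)) (sym (exchange f′ (_⊑? J) I)))

-- Rotations of permutations and the generating functions

concatMap-cartesianProductWith : ∀ {A B C : Set} (f : A → B → C) xs ys →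
  concatMap (λ x → map (f x) ys) xs ≡ cartesianProductWith f xs ys
concatMap-cartesianProductWith f [] ys = refl
concatMap-cartesianProductWith f (x ∷ xs) ys = cong (map (f x) ys ++_) (concatMap-cartesianProductWith f xs ys)

allVecs-suc : ∀ {n} k → allVecs {n} (suc k) ≡ cartesianProductWith (λ v a → a ∷ v) (allVecs k) (allFin n)
allVecs-suc {n} k = concatMap-cartesianProductWith (λ v a → a ∷ v) (allVecs k) (allFin n)

allVecs-unique : ∀ {n} k → Unique (allVecs {n} k)
allVecs-unique zero = [] ∷ []
allVecs-unique {n} (suc k) = subst Unique (sym (allVecs-suc k))
  (Uniqueₚ.cartesianProductWith⁺ (λ v a → a ∷ v) (λ { refl → refl , refl }) (allVecs-unique k) (Uniqueₚ.allFin⁺ n))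

∈-allVecs : ∀ {n k} (v : Vec (Fin n) k) → v ∈ allVecs k
∈-allVecs [] = here refl
∈-allVecs {n} {suc k} (a ∷ v) = subst ((a ∷ v) ∈_) (sym (allVecs-suc k))
  (∈-cartesianProductWith⁺ (λ v a → a ∷ v) (∈-allVecs v) (∈-allFin a))

Sym-unique : ∀ n → Unique (Sym n)
Sym-unique n = Uniqueₚ.filter⁺ isPerm? (allVecs-unique n)

∈-Sym⁺ : ∀ {n} (π : Word n) → IsPerm π → π ∈ Sym n
∈-Sym⁺ π perm = ∈-filter⁺ isPerm? (∈-allVecs π) perm

∈-Sym⁻ : ∀ {n} {π : Word n} → π ∈ Sym n → IsPerm π
∈-Sym⁻ {n} π∈ = proj₂ (∈-filter⁻ isPerm? {xs = allVecs n} π∈)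

fixesLast? : ∀ {k} (σ : Word (suc k)) → Dec (FixesLast σ)
fixesLast? {k} σ = lookup σ (fromℕ k) F.≟ fromℕ k

SymFixingLast : ∀ k → List (Word (suc k))
SymFixingLast k = filter fixesLast? (Sym (suc k))

SymFixingLast-unique : ∀ k → Unique (SymFixingLast k)
SymFixingLast-unique k = Uniqueₚ.filter⁺ fixesLast? (Sym-unique (suc k))

∈-SymFixingLast⁺ : ∀ {k} (σ : Word (suc k)) → IsPerm σ → FixesLast σ → σ ∈ SymFixingLast k
∈-SymFixingLast⁺ σ perm fix = ∈-filter⁺ fixesLast? (∈-Sym⁺ σ perm) fix

∈-SymFixingLast⁻ : ∀ {k} {σ : Word (suc k)} → σ ∈ SymFixingLast k → IsPerm σ × FixesLast σ
∈-SymFixingLast⁻ {k} σ∈ =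
  let σ∈Sym , fix = ∈-filter⁻ fixesLast? {xs = Sym (suc k)} σ∈ in ∈-Sym⁻ σ∈Sym , fix

InverseDes : ∀ {m} → Subset m → List (Word (suc (suc m)))
InverseDes {m} J = filter (λ σ → Des (inv σ) ≟ₛ J) (SymFixingLast (suc m))

∈-InverseDes⁻ : ∀ {m} {J : Subset m} {σ} → σ ∈ InverseDes J → IsPerm σ × FixesLast σ × Des (inv σ) ≡ J
∈-InverseDes⁻ {m} {J} σ∈ =
  let σ∈Sym , des = ∈-filter⁻ (λ σ → Des (inv σ) ≟ₛ J) {xs = SymFixingLast (suc m)} σ∈
      perm , fix = ∈-SymFixingLast⁻ σ∈Sym
  in perm , fix , des

module _ {m : ℕ} (J I : Subset m) (p′ : Fin (suc m)) where

  open Correspondence J I p′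
  open ShiftedWord J I p′ using (shiftedWord)
  open Pivot {ℓ = suc (suc m)} (cuts I) (inject₁ (opposite p′)) using (plainSort; pivotSort)

  private
    base : List (Word (suc (suc m)))
    base = filter (λ σ → Des (inv σ) ⊑? J) (SymFixingLast (suc m))

    members : (Word (suc (suc m)) → Subset m) → List (Word (suc (suc m)))
    members f = filter (λ σ → f σ ⊑? I) base

    members⁻ : ∀ f {σ} → σ ∈ members f → IsPerm σ × FixesLast σ × Des (inv σ) ⊑ J × f σ ⊑ I
    members⁻ f σ∈ =
      let σ∈base , f⊑ = ∈-filter⁻ (λ σ → f σ ⊑? I) {xs = base} σ∈
          σ∈Sym , iDes⊑ = ∈-filter⁻ (λ σ → Des (inv σ) ⊑? J) {xs = SymFixingLast (suc m)} σ∈base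
          perm , fix = ∈-SymFixingLast⁻ σ∈Sym
      in perm , fix , iDes⊑ , f⊑

    members⁺ : ∀ f {σ} → IsPerm σ × FixesLast σ × Des (inv σ) ⊑ J × f σ ⊑ I → σ ∈ members f
    members⁺ f {σ} (perm , fix , iDes⊑ , f⊑) = ∈-filter⁺ (λ σ → f σ ⊑? I)
      (∈-filter⁺ (λ σ → Des (inv σ) ⊑? J) (∈-SymFixingLast⁺ σ perm fix) iDes⊑) f⊑

    members-unique : ∀ f → Unique (members f)
    members-unique f = Uniqueₚ.filter⁺ (λ σ → f σ ⊑? I)
      (Uniqueₚ.filter⁺ (λ σ → Des (inv σ) ⊑? J) (SymFixingLast-unique (suc m)))

    shiftDes : Word (suc (suc m)) → Subset m
    shiftDes σ = Des (shift (inject₁ p′) σ)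

  -- Each direction sends a permutation to the one realizing its re-sorted word; injectivity comes
  -- from the opposite sort restoring the word.
  ♯-shift : length (members shiftDes) ≡ length (members Des)
  ♯-shift = ℕₚ.≤-antisym
    (length-≤-injection (λ σ τ → plainWord τ ≡ plainSort (shiftedWord σ)) _ _ (members-unique shiftDes)
      (λ {σ} σ∈ → let τ , Pτ , eq = shifted⇒plain σ (members⁻ shiftDes σ∈) in τ , members⁺ Des Pτ , eq)
      (λ {σ} {σ′} σ∈ σ′∈ e e′ → plainSort-injective σ σ′ (members⁻ shiftDes σ∈) (members⁻ shiftDes σ′∈) (trans (sym e) e′)))
    (length-≤-injection (λ σ τ → shiftedWord τ ≡ pivotSort (plainWord σ)) _ _ (members-unique Des)
      (λ {σ} σ∈ → let τ , Sτ , eq = plain⇒shifted σ (members⁻ Des σ∈) in τ , members⁺ shiftDes Sτ , eq)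
      (λ {σ} {σ′} σ∈ σ′∈ e e′ → pivotSort-injective σ σ′ (members⁻ Des σ∈) (members⁻ Des σ′∈) (trans (sym e) e′)))

rot-zero : ∀ {k} r → r < suc k → toℕ (rot {k} r zero) ≡ r
rot-zero r r<n = trans (toℕ-rot-< r zero (subst (_< _) (sym (ℕₚ.+-identityʳ r)) r<n)) (ℕₚ.+-identityʳ r)

-- One more step takes the last index to 0, so the image of n under a rotation reveals its exponent.
next-toLast-last : ∀ {k} (v : Fin (suc k)) → toℕ (next (toLast v (fromℕ k))) ≡ toℕ (opposite v)
next-toLast-last {k} v = trans (cong toℕ (sym (rot-next (toℕ (opposite v)) (fromℕ k))))
  (trans (cong (toℕ ∘ toLast v) (next-last k)) (rot-zero (toℕ (opposite v)) (Fₚ.toℕ<n (opposite v))))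

toLast-last-injective : ∀ {k} {v w : Fin (suc k)} → toLast v (fromℕ k) ≡ toLast w (fromℕ k) → v ≡ w
toLast-last-injective {v = v} {w} eq = trans (sym (Fₚ.opposite-involutive v))
  (trans (cong opposite (Fₚ.toℕ-injective (trans (sym (next-toLast-last v))
    (trans (cong (toℕ ∘ next) eq) (next-toLast-last w))))) (Fₚ.opposite-involutive w))

shift-last : ∀ {k} (σ : Word (suc k)) → FixesLast σ → shift (fromℕ k) σ ≡ σ
shift-last {k} σ fix = lookup-ext λ i → trans (lookup-shift (fromℕ k) σ i)
  (trans (cong₂ (λ v j → toLast v (lookup σ j)) fix full) (cong (λ r → rot r (lookup σ i)) zero′))
  where
  zero′ : toℕ (opposite (fromℕ k)) ≡ 0
  zero′ = ℕₚ.+-cancelʳ-≡ k _ _ (trans (cong (toℕ (opposite (fromℕ k)) +_) (sym (Fₚ.toℕ-fromℕ k))) (toℕ-opposite-+ (fromℕ k)))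
  full : ∀ {i} → fromLast (fromℕ k) i ≡ i
  full {i} = trans (cong (λ r → rot (suc r) i) (Fₚ.toℕ-fromℕ k)) (rot-full i)

shift-Des-↭ : ∀ {m} (J : Subset m) p → map (Des ∘ shift p) (InverseDes J) ↭ map Des (InverseDes J)
shift-Des-↭ J p with view p
-- With p the last position there is no q, as p + q = m is unsolvable; but then nothing is rotated,
-- because σ fixes n.
... | ‵fromℕ = ↭-reflexive (map-cong-local (All.tabulate λ {σ} σ∈ →
  cong Des (shift-last σ (proj₁ (proj₂ (∈-InverseDes⁻ σ∈))))))
... | ‵inj₁ {i = p′} _ = joint-↭ (Des ∘ inv) (Des ∘ shift (inject₁ p′)) Des (SymFixingLast _) (λ J I → ♯-shift J I p′) J

-- The two product sets as families of rotations

rotateValues rotatePositions : ∀ {k} → Fin (suc k) → Word (suc k) → Word (suc k)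
rotateValues p σ    = tabulate λ i → toLast (lookup σ p) (lookup σ i)
rotatePositions p σ = tabulate λ i → lookup σ (toLast p i)

module _ {k : ℕ} (p : Fin (suc k)) (σ : Word (suc k)) where

  lookup-rotateValues : ∀ i → lookup (rotateValues p σ) i ≡ toLast (lookup σ p) (lookup σ i)
  lookup-rotateValues = Vecₚ.lookup∘tabulate λ i → toLast (lookup σ p) (lookup σ i)

  lookup-rotatePositions : ∀ i → lookup (rotatePositions p σ) i ≡ lookup σ (toLast p i)
  lookup-rotatePositions = Vecₚ.lookup∘tabulate λ i → lookup σ (toLast p i)

  rotateValues-perm : IsPerm σ → IsPerm (rotateValues p σ)
  rotateValues-perm perm i j eq = perm i j (toLast-injective (lookup σ p)
    (trans (sym (lookup-rotateValues i)) (trans eq (lookup-rotateValues j))))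

  rotatePositions-perm : IsPerm σ → IsPerm (rotatePositions p σ)
  rotatePositions-perm perm i j eq = toLast-injective p (perm _ _
    (trans (sym (lookup-rotatePositions i)) (trans eq (lookup-rotatePositions j))))

  rotateValues-p : lookup (rotateValues p σ) p ≡ fromℕ k
  rotateValues-p = trans (lookup-rotateValues p) (toLast-self (lookup σ p))

  rotatePositions-p : FixesLast σ → lookup (rotatePositions p σ) p ≡ fromℕ k
  rotatePositions-p fix = trans (lookup-rotatePositions p) (trans (cong (lookup σ) (toLast-self p)) fix)

  -- `shift` contains exactly the position rotation that is undone here. Hence one weight formula,
  -- for rotated positions, serves both sides of the theorem.
  rotateValues≡rotatePositions-shift : rotateValues p σ ≡ rotatePositions p (shift p σ)
  rotateValues≡rotatePositions-shift = lookup-ext λ i → trans (lookup-rotateValues i) (sym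
    (trans (Vecₚ.lookup∘tabulate (λ i → lookup (shift p σ) (toLast p i)) i)
    (trans (lookup-shift p σ (toLast p i)) (cong (toLast (lookup σ p) ∘ lookup σ) (fromLast-toLast p i)))))

  shift-perm : IsPerm σ → IsPerm (shift p σ)
  shift-perm perm i j eq = fromLast-injective p (perm _ _ (toLast-injective (lookup σ p)
    (trans (sym (lookup-shift p σ i)) (trans eq (lookup-shift p σ j)))))

  shift-fixesLast : FixesLast (shift p σ)
  shift-fixesLast = trans (lookup-shift p σ (fromℕ k))
    (trans (cong (toLast (lookup σ p) ∘ lookup σ) (fromLast-last p)) (toLast-self (lookup σ p)))

-- The position of n gives p, and the image of the value n gives the exponent; then the rotation can
-- be undone.
rotateValues-injective : ∀ {k} {p p₁ : Fin (suc k)} {σ σ₁} → IsPerm σ → FixesLast σ → FixesLast σ₁ →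
  rotateValues p σ ≡ rotateValues p₁ σ₁ → (p , σ) ≡ (p₁ , σ₁)
rotateValues-injective {k} {p} {p₁} {σ} {σ₁} perm fix fix₁ eq = cong₂ _,_ p≡p₁ (lookup-ext λ i →
  toLast-injective (lookup σ p) (trans (values i) (cong (λ v → toLast v (lookup σ₁ i)) (sym v≡v₁))))
  where
  p≡p₁ : p ≡ p₁
  p≡p₁ = rotateValues-perm p σ perm p p₁ (trans (rotateValues-p p σ)
    (sym (trans (cong (λ u → lookup u p₁) eq) (rotateValues-p p₁ σ₁))))
  values : ∀ i → toLast (lookup σ p) (lookup σ i) ≡ toLast (lookup σ₁ p₁) (lookup σ₁ i)
  values i = trans (sym (lookup-rotateValues p σ i)) (trans (cong (λ u → lookup u i) eq) (lookup-rotateValues p₁ σ₁ i))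
  v≡v₁ : lookup σ p ≡ lookup σ₁ p₁
  v≡v₁ = toLast-last-injective (subst₂ (λ a b → toLast (lookup σ p) a ≡ toLast (lookup σ₁ p₁) b) fix fix₁ (values (fromℕ k)))

rotatePositions-injective : ∀ {k} {p p₁ : Fin (suc k)} {σ σ₁} → IsPerm σ → FixesLast σ → FixesLast σ₁ →
  rotatePositions p σ ≡ rotatePositions p₁ σ₁ → (p , σ) ≡ (p₁ , σ₁)
rotatePositions-injective {k} {p} {p₁} {σ} {σ₁} perm fix fix₁ eq
  with refl ← rotatePositions-perm p σ perm p p₁ (trans (rotatePositions-p p σ fix)
    (sym (trans (cong (λ u → lookup u p₁) eq) (rotatePositions-p p₁ σ₁ fix₁)))) =
  cong (p ,_) (lookup-ext λ i → subst (λ j → lookup σ j ≡ lookup σ₁ j) (toLast-fromLast p i)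
    (trans (sym (lookup-rotatePositions p σ _)) (trans (cong (λ u → lookup u (fromLast p i)) eq) (lookup-rotatePositions p σ₁ _))))

unique-map : ∀ {A B : Set} (f : A → B) xs → (∀ {x y} → x ∈ xs → y ∈ xs → f x ≡ f y → x ≡ y) →
  Unique xs → Unique (map f xs)
unique-map f [] inj [] = []
unique-map f (x ∷ xs) inj (x∉xs ∷ u) =
  Allₚ.map⁺ (All.tabulate λ y∈xs eq → All.lookup x∉xs y∈xs (inj (here refl) (there y∈xs) eq)) ∷
  unique-map f xs (λ p q → inj (there p) (there q)) u

module _ {n : ℕ} (X Y : List (Word n)) where

  ∈-Prod⁺ : ∀ {x y π} → x ∈ X → y ∈ Y → IsPerm π → π ≡ x ∘ₚ y → π ∈ Prod X Y
  ∈-Prod⁺ {x} {y} {π} x∈X y∈Y perm eq = ∈-filter⁺ (inProd? X Y) (∈-Sym⁺ π perm)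
    (lose {P = λ x → Any (λ y → π ≡ x ∘ₚ y) Y} x∈X (lose {P = λ y → π ≡ x ∘ₚ y} y∈Y eq))

  ∈-Prod⁻ : ∀ {π} → π ∈ Prod X Y → ∃ λ x → ∃ λ y → x ∈ X × y ∈ Y × π ≡ x ∘ₚ y
  ∈-Prod⁻ π∈ =
    let _ , prod = ∈-filter⁻ (inProd? X Y) {xs = Sym n} π∈
        x , x∈X , rest = find prod
        y , y∈Y , eq = find rest
    in x , y , x∈X , y∈Y , eq

  Prod-unique : Unique (Prod X Y)
  Prod-unique = Uniqueₚ.filter⁺ (inProd? X Y) (Sym-unique n)

module _ {m : ℕ} (J : Subset m) where

  private
    n : ℕ
    n = suc (suc m)

    pairs : List (Fin n × Word n)
    pairs = cartesianProduct (allFin n) (InverseDes J)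

    pairs-unique : Unique pairs
    pairs-unique = Uniqueₚ.cartesianProduct⁺ (Uniqueₚ.allFin⁺ n)
      (Uniqueₚ.filter⁺ (λ σ → Des (inv σ) ≟ₛ J) (SymFixingLast-unique (suc m)))

    pairs⁻ : ∀ {p σ} → (p , σ) ∈ pairs → IsPerm σ × FixesLast σ × Des (inv σ) ≡ J
    pairs⁻ pσ∈ = ∈-InverseDes⁻ (proj₂ (∈-cartesianProduct⁻ (allFin n) (InverseDes J) pσ∈))

    pairs⁺ : ∀ {p σ} → IsPerm σ × FixesLast σ × Des (inv σ) ≡ J → (p , σ) ∈ pairs
    pairs⁺ {p} {σ} (perm , fix , des) = ∈-cartesianProduct⁺ (∈-allFin p)
      (∈-filter⁺ (λ σ → Des (inv σ) ≟ₛ J) (∈-SymFixingLast⁺ σ perm fix) des)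

    inv-fixesLast : ∀ (σ : Word n) → IsPerm σ → FixesLast σ → FixesLast (inv σ)
    inv-fixesLast σ perm fix = trans (cong (lookup (inv σ)) (sym fix)) (inv-left σ perm _)

    Dinv⁻ : ∀ {σ} → σ ∈ Dinv J → IsPerm σ × FixesLast σ × Des (inv σ) ≡ J
    Dinv⁻ σ∈ =
      let τ , τ∈D , σ≡ = ∈-map⁻ inv σ∈
          τ∈Sym , fix , des = ∈-filter⁻ (inD? J) {xs = Sym n} τ∈D
          perm = ∈-Sym⁻ τ∈Sym
      in subst (λ σ → IsPerm σ × FixesLast σ × Des (inv σ) ≡ J) (sym σ≡)
        (inv-perm τ perm , inv-fixesLast τ perm fix , trans (cong Des (inv-inv τ perm)) des)

    Dinv⁺ : ∀ {σ} → IsPerm σ → FixesLast σ → Des (inv σ) ≡ J → σ ∈ Dinv J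
    Dinv⁺ {σ} perm fix des = subst (_∈ Dinv J) (inv-inv σ perm) (∈-map⁺ inv
      (∈-filter⁺ (inD? J) (∈-Sym⁺ (inv σ) (inv-perm σ perm)) (inv-fixesLast σ perm fix , des)))

    Cyc⁻ : ∀ {c} → c ∈ Cyc (suc m) → ∃ λ v → c ≡ cycPow (toℕ (opposite {n} v))
    Cyc⁻ c∈ =
      let r , r∈ , c≡ = ∈-map⁻ cycPow c∈
          v , r≡ = toℕ-opposite-surjective (∈-upTo⁻ r∈)
      in v , trans c≡ (cong cycPow r≡)

    Cyc⁺ : ∀ v → cycPow (toℕ (opposite {n} v)) ∈ Cyc (suc m)
    Cyc⁺ v = ∈-map⁺ cycPow (∈-upTo⁺ (Fₚ.toℕ<n (opposite v)))

    cycPow-∘ₚ : ∀ p (σ : Word n) → cycPow (toℕ (opposite (lookup σ p))) ∘ₚ σ ≡ rotateValues p σ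
    cycPow-∘ₚ p σ = lookup-ext λ i → trans (lookup-∘ₚ (cycPow (toℕ (opposite (lookup σ p)))) σ i)
      (trans (lookup-cycPow (toℕ (opposite (lookup σ p))) (lookup σ i)) (sym (lookup-rotateValues p σ i)))

    ∘ₚ-cycPow : ∀ p (σ : Word n) → σ ∘ₚ cycPow (toℕ (opposite p)) ≡ rotatePositions p σ
    ∘ₚ-cycPow p σ = lookup-ext λ i → trans (lookup-∘ₚ σ (cycPow (toℕ (opposite p))) i)
      (trans (cong (lookup σ) (lookup-cycPow (toℕ (opposite p)) i)) (sym (lookup-rotatePositions p σ i)))

    Cyc-Dinv : ∀ {π} → π ∈ Prod (Cyc (suc m)) (Dinv J) ⇔ π ∈ map (uncurry rotateValues) pairs
    Cyc-Dinv {π} = mk⇔ to from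
      where
      to : π ∈ Prod (Cyc (suc m)) (Dinv J) → π ∈ map (uncurry rotateValues) pairs
      to π∈ =
        let c , σ , c∈ , σ∈ , π≡ = ∈-Prod⁻ (Cyc (suc m)) (Dinv J) π∈
            v , c≡ = Cyc⁻ c∈
            perm , fix , des = Dinv⁻ σ∈
            -- The power of the cycle sends the value v to n, so n ends up where σ takes the value
            -- v.
            p = lookup (inv σ) v
            σp≡v = inv-right σ perm v
        in subst (_∈ map (uncurry rotateValues) pairs)
          (trans (sym (cycPow-∘ₚ p σ)) (trans (cong (λ w → cycPow (toℕ (opposite w)) ∘ₚ σ) σp≡v)
            (trans (cong (_∘ₚ σ) (sym c≡)) (sym π≡))))
          (∈-map⁺ (uncurry rotateValues) (pairs⁺ {p} {σ} (perm , fix , des)))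
      from : π ∈ map (uncurry rotateValues) pairs → π ∈ Prod (Cyc (suc m)) (Dinv J)
      from π∈ =
        let (p , σ) , pσ∈ , π≡ = ∈-map⁻ (uncurry rotateValues) π∈
            perm , fix , des = pairs⁻ pσ∈
        in ∈-Prod⁺ (Cyc (suc m)) (Dinv J) (Cyc⁺ (lookup σ p)) (Dinv⁺ {σ} perm fix des)
          (subst IsPerm (sym π≡) (rotateValues-perm p σ perm)) (trans π≡ (sym (cycPow-∘ₚ p σ)))

    Dinv-Cyc : ∀ {π} → π ∈ Prod (Dinv J) (Cyc (suc m)) ⇔ π ∈ map (uncurry rotatePositions) pairs
    Dinv-Cyc {π} = mk⇔ to from
      where
      to : π ∈ Prod (Dinv J) (Cyc (suc m)) → π ∈ map (uncurry rotatePositions) pairs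
      to π∈ =
        let σ , c , σ∈ , c∈ , π≡ = ∈-Prod⁻ (Dinv J) (Cyc (suc m)) π∈
            p , c≡ = Cyc⁻ c∈
        in subst (_∈ map (uncurry rotatePositions) pairs)
          (trans (sym (∘ₚ-cycPow p σ)) (trans (cong (σ ∘ₚ_) (sym c≡)) (sym π≡)))
          (∈-map⁺ (uncurry rotatePositions) (pairs⁺ {p} {σ} (Dinv⁻ σ∈)))
      from : π ∈ map (uncurry rotatePositions) pairs → π ∈ Prod (Dinv J) (Cyc (suc m))
      from π∈ =
        let (p , σ) , pσ∈ , π≡ = ∈-map⁻ (uncurry rotatePositions) π∈
            perm , fix , des = pairs⁻ pσ∈
        in ∈-Prod⁺ (Dinv J) (Cyc (suc m)) (Dinv⁺ {σ} perm fix des) (Cyc⁺ p)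
          (subst IsPerm (sym π≡) (rotatePositions-perm p σ perm)) (trans π≡ (sym (∘ₚ-cycPow p σ)))

  -- Neither list has repetitions, so equality of members is enough; on the right this depends on
  -- distinct pairs giving distinct rotations.
  Cyc-Dinv-↭ : Prod (Cyc (suc m)) (Dinv J) ↭ map (uncurry rotateValues) (cartesianProduct (allFin n) (InverseDes J))
  Cyc-Dinv-↭ = ∼bag⇒↭ (Memₖ.unique∧set⇒bag
    (Prod-unique (Cyc (suc m)) (Dinv J))
    (unique-map (uncurry rotateValues) pairs
      (λ { {p , σ} {p₁ , σ₁} a∈ b∈ → let perm , fix , _ = pairs⁻ a∈ ; _ , fix₁ , _ = pairs⁻ b∈
                                      in rotateValues-injective perm fix fix₁ }) pairs-unique)
    Cyc-Dinv)

  Dinv-Cyc-↭ : Prod (Dinv J) (Cyc (suc m)) ↭ map (uncurry rotatePositions) (cartesianProduct (allFin n) (InverseDes J))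
  Dinv-Cyc-↭ = ∼bag⇒↭ (Memₖ.unique∧set⇒bag
    (Prod-unique (Dinv J) (Cyc (suc m)))
    (unique-map (uncurry rotatePositions) pairs
      (λ { {p , σ} {p₁ , σ₁} a∈ b∈ → let perm , fix , _ = pairs⁻ a∈ ; _ , fix₁ , _ = pairs⁻ b∈
                                      in rotatePositions-injective perm fix fix₁ }) pairs-unique)
    Dinv-Cyc)

-- For a permutation fixing n, the cyclic descents beyond Des are forced: n - 1 is none, n is one.
cyclicBit : ∀ {m} → Subset m → Fin (suc (suc m)) → Bool
cyclicBit []      zero       = false
cyclicBit []      (suc zero) = true
cyclicBit (b ∷ I) zero       = b
cyclicBit (b ∷ I) (suc i)    = cyclicBit I i

cyclicBit-inject₁ : ∀ {m} (I : Subset m) i → cyclicBit I (inject₁ (inject₁ i)) ≡ lookup I i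
cyclicBit-inject₁ (b ∷ I) zero    = refl
cyclicBit-inject₁ (b ∷ I) (suc i) = cyclicBit-inject₁ I i

cyclicBit-penultimate : ∀ {m} (I : Subset m) → cyclicBit I (inject₁ (fromℕ m)) ≡ false
cyclicBit-penultimate []      = refl
cyclicBit-penultimate (b ∷ I) = cyclicBit-penultimate I

cyclicBit-last : ∀ {m} (I : Subset m) → cyclicBit I (fromℕ (suc m)) ≡ true
cyclicBit-last []      = refl
cyclicBit-last (b ∷ I) = cyclicBit-last I

cyclicBit-Des : ∀ {m} (ρ : Word (suc (suc m))) → IsPerm ρ → FixesLast ρ →
  ∀ k → does (lookup ρ (next k) F.<? lookup ρ k) ≡ cyclicBit (Des ρ) k
cyclicBit-Des {m} ρ perm fix k with view k
... | ‵fromℕ = trans (dec-true (_ F.<? _) first<last) (sym (cyclicBit-last (Des ρ)))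
  where
  first<last : lookup ρ (next (fromℕ (suc m))) F.< lookup ρ (fromℕ (suc m))
  first<last = subst₂ (λ a b → lookup ρ a F.< b) (sym (next-last (suc m))) (sym fix)
    (ℕₚ.≤∧≢⇒< (Fₚ.≤fromℕ (lookup ρ zero)) λ eq →
      contradiction (perm zero (fromℕ (suc m)) (trans (Fₚ.toℕ-injective eq) (sym fix))) λ ())
... | ‵inj₁ {i = j} _ with view j
...   | ‵fromℕ = trans (dec-false (_ F.<? _) (ℕₚ.≤⇒≯ ≤last)) (sym (cyclicBit-penultimate (Des ρ)))
  where
  ≤last : lookup ρ (inject₁ (fromℕ m)) F.≤ lookup ρ (next (inject₁ (fromℕ m)))
  ≤last = subst (lookup ρ (inject₁ (fromℕ m)) F.≤_)
    (sym (trans (cong (lookup ρ) (next-inject₁ (fromℕ m))) fix)) (Fₚ.≤fromℕ _)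
...   | ‵inj₁ {i = i} _ = trans
  (cong (λ a → does (lookup ρ a F.<? lookup ρ (inject₁ (inject₁ i)))) (next-inject₁ (inject₁ i)))
  (sym (trans (cyclicBit-inject₁ (Des ρ) i) (lookup-Des ρ i)))

-- Generating functions

module Sums {c ℓ : Level} (R : CommutativeSemiring c ℓ) where
  open CommutativeSemiring R using (Carrier; _≈_; 0#; 1#; _*_; setoid; rawSemiring; +-cong; +-congˡ; +-assoc; +-comm; +-identityˡ)
    renaming (_+_ to infixl 6 _⊕_; refl to ≈-refl; sym to ≈-sym; trans to ≈-trans; reflexive to ≈-reflexive)
  open Weights R
  open import Algebra.Definitions.RawSemiring rawSemiring using (_^_)
  open import Relation.Binary.Reasoning.Setoid setoid

  Σ[_] : ∀ {A : Set} → List A → (A → Carrier) → Carrier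
  Σ[ xs ] f = foldr (λ a acc → f a ⊕ acc) 0# xs

  Σ-↭ : ∀ {A : Set} (f : A → Carrier) {xs ys} → xs ↭ ys → Σ[ xs ] f ≈ Σ[ ys ] f
  Σ-↭ f Perm.refl         = ≈-refl
  Σ-↭ f (Perm.prep x p)   = +-congˡ (Σ-↭ f p)
  Σ-↭ f (Perm.swap {xs} {ys} x y p) = begin
    f x ⊕ (f y ⊕ Σ[ xs ] f) ≈⟨ +-assoc (f x) (f y) _ ⟨
    f x ⊕ f y ⊕ Σ[ xs ] f   ≈⟨ +-cong (+-comm (f x) (f y)) (Σ-↭ f p) ⟩
    f y ⊕ f x ⊕ Σ[ ys ] f   ≈⟨ +-assoc (f y) (f x) _ ⟩
    f y ⊕ (f x ⊕ Σ[ ys ] f) ∎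
  Σ-↭ f (Perm.trans p q)  = ≈-trans (Σ-↭ f p) (Σ-↭ f q)

  Σ-map : ∀ {A B : Set} (g : A → B) (f : B → Carrier) xs → Σ[ map g xs ] f ≡ Σ[ xs ] (f ∘ g)
  Σ-map g f []       = refl
  Σ-map g f (x ∷ xs) = cong (f (g x) ⊕_) (Σ-map g f xs)

  Σ-cong : ∀ {A : Set} {f g : A → Carrier} xs → (∀ {x} → x ∈ xs → f x ≈ g x) → Σ[ xs ] f ≈ Σ[ xs ] g
  Σ-cong []       h = ≈-refl
  Σ-cong (x ∷ xs) h = +-cong (h (here refl)) (Σ-cong xs (h ∘ there))

  Σ-++ : ∀ {A : Set} (f : A → Carrier) xs ys → Σ[ xs ++ ys ] f ≈ Σ[ xs ] f ⊕ Σ[ ys ] f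
  Σ-++ f []       ys = ≈-sym (+-identityˡ _)
  Σ-++ f (x ∷ xs) ys = ≈-trans (+-congˡ (Σ-++ f xs ys)) (≈-sym (+-assoc (f x) _ _))

  Σ-cartesianProduct : ∀ {A B : Set} (f : A × B → Carrier) xs ys →
    Σ[ cartesianProduct xs ys ] f ≈ Σ[ xs ] (λ x → Σ[ ys ] (λ y → f (x , y)))
  Σ-cartesianProduct f []       ys = ≈-refl
  Σ-cartesianProduct f (x ∷ xs) ys = ≈-trans (Σ-++ f (map (x ,_) ys) (cartesianProduct xs ys))
    (+-cong (≈-reflexive (Σ-map (x ,_) f ys)) (Σ-cartesianProduct f xs ys))

  module _ {m : ℕ} (x : Fin (suc (suc m)) → Carrier) (t : Carrier) where

    desWeight : Fin (suc (suc m)) → Subset m → Carrier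
    desWeight p I = foldr (λ i acc → (if cyclicBit I (toLast p i) then x i else 1#) * acc) 1# (allFin _)
      * (t ^ suc (toℕ p))

    -- Rotating positions commutes with `next`, so the cyclic descents are only relabelled, and
    -- those of ρ are determined by `Des ρ`. The entry n stands at p, which gives the exponent p + 1
    -- of t, counted from 1.
    weight-rotatePositions : ∀ p ρ → IsPerm ρ → FixesLast ρ →
      weight x t (rotatePositions p ρ) ≡ desWeight p (Des ρ)
    weight-rotatePositions p ρ perm fix = cong₂ (λ a j → a * (t ^ suc (toℕ j))) (bits (allFin _))
      (trans (cong (lookup (inv π)) (sym (rotatePositions-p p ρ fix)))
        (inv-left π (rotatePositions-perm p ρ perm) p))
      where
      π : Word (suc (suc m))
      π = rotatePositions p ρ
      bit : ∀ i → does (lookup π (next i) F.<? lookup π i) ≡ cyclicBit (Des ρ) (toLast p i)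
      bit i = trans (cong₂ (λ a b → does (a F.<? b))
        (trans (lookup-rotatePositions p ρ (next i)) (cong (lookup ρ) (rot-next (toℕ (opposite p)) i)))
        (lookup-rotatePositions p ρ i)) (cyclicBit-Des ρ perm fix (toLast p i))
      bits : ∀ is →
        foldr (λ i acc → (if does (lookup π (next i) F.<? lookup π i) then x i else 1#) * acc) 1# is ≡
        foldr (λ i acc → (if cyclicBit (Des ρ) (toLast p i) then x i else 1#) * acc) 1# is
      bits []       = refl
      bits (i ∷ is) = cong₂ (λ b acc → (if b then x i else 1#) * acc) (bit i) (bits is)

    weight-rotateValues : ∀ p σ → IsPerm σ →
      weight x t (rotateValues p σ) ≡ desWeight p (Des (shift p σ))
    weight-rotateValues p σ perm = trans (cong (weight x t) (rotateValues≡rotatePositions-shift p σ))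
      (weight-rotatePositions p (shift p σ) (shift-perm p σ perm) (shift-fixesLast p σ))

    -- The identity already holds for each final position p of n, that is, for each power of t;
    -- there both sums add one function of the descent set over the two equidistributed lists.
    Σ-rotations : ∀ J p →
      Σ[ InverseDes J ] (λ σ → weight x t (rotateValues p σ)) ≈
      Σ[ InverseDes J ] (λ σ → weight x t (rotatePositions p σ))
    Σ-rotations J p = begin
      Σ[ InverseDes J ] (λ σ → weight x t (rotateValues p σ))
        ≈⟨ Σ-cong (InverseDes J) (λ {σ} σ∈ → ≈-reflexive (weight-rotateValues p σ (proj₁ (∈-InverseDes⁻ σ∈)))) ⟩
      Σ[ InverseDes J ] (desWeight p ∘ Des ∘ shift p)
        ≡⟨ Σ-map (Des ∘ shift p) (desWeight p) (InverseDes J) ⟨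
      Σ[ map (Des ∘ shift p) (InverseDes J) ] (desWeight p)
        ≈⟨ Σ-↭ (desWeight p) (shift-Des-↭ J p) ⟩
      Σ[ map Des (InverseDes J) ] (desWeight p)
        ≡⟨ Σ-map Des (desWeight p) (InverseDes J) ⟩
      Σ[ InverseDes J ] (desWeight p ∘ Des)
        ≈⟨ Σ-cong (InverseDes J) (λ {σ} σ∈ → let perm , fix , _ = ∈-InverseDes⁻ σ∈ in
             ≈-reflexive (sym (weight-rotatePositions p σ perm fix))) ⟩
      Σ[ InverseDes J ] (λ σ → weight x t (rotatePositions p σ)) ∎

    Σ-rotated : ∀ J (rotate : Fin (suc (suc m)) → Word (suc (suc m)) → Word (suc (suc m))) {πs} →
      πs ↭ map (uncurry rotate) (cartesianProduct (allFin _) (InverseDes J)) →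
      sumOver πs (weight x t) ≈ Σ[ allFin _ ] (λ p → Σ[ InverseDes J ] (λ σ → weight x t (rotate p σ)))
    Σ-rotated J rotate {πs} h = begin
      Σ[ πs ] (weight x t)                                 ≈⟨ Σ-↭ (weight x t) h ⟩
      Σ[ map (uncurry rotate) pairs ] (weight x t)         ≡⟨ Σ-map (uncurry rotate) (weight x t) pairs ⟩
      Σ[ pairs ] (weight x t ∘ uncurry rotate)
        ≈⟨ Σ-cartesianProduct (weight x t ∘ uncurry rotate) (allFin _) (InverseDes J) ⟩
      Σ[ allFin _ ] (λ p → Σ[ InverseDes J ] (λ σ → weight x t (rotate p σ))) ∎
      where
      pairs : List (Fin (suc (suc m)) × Word (suc (suc m)))
      pairs = cartesianProduct (allFin _) (InverseDes J)

theorem4p1 : {c ℓ : Level} (R : CommutativeSemiring c ℓ) (m : ℕ) (J : Subset m)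
    (x : Fin (suc (suc m)) → CommutativeSemiring.Carrier R)
    (t : CommutativeSemiring.Carrier R) →
    CommutativeSemiring._≈_ R
    (Weights.sumOver R (Prod (Cyc (suc m)) (Dinv J)) (Weights.weight R x t))
    (Weights.sumOver R (Prod (Dinv J) (Cyc (suc m))) (Weights.weight R x t))
theorem4p1 R m J x t = begin
  sumOver (Prod (Cyc (suc m)) (Dinv J)) (weight x t)
    ≈⟨ Σ-rotated x t J rotateValues (Cyc-Dinv-↭ J) ⟩
  Σ[ allFin _ ] (λ p → Σ[ InverseDes J ] (λ σ → weight x t (rotateValues p σ)))
    ≈⟨ Σ-cong (allFin _) (λ {p} _ → Σ-rotations x t J p) ⟩
  Σ[ allFin _ ] (λ p → Σ[ InverseDes J ] (λ σ → weight x t (rotatePositions p σ)))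
    ≈⟨ Σ-rotated x t J rotatePositions (Dinv-Cyc-↭ J) ⟨
  sumOver (Prod (Dinv J) (Cyc (suc m))) (weight x t) ∎
  where
  open Weights R
  open Sums R
  open import Relation.Binary.Reasoning.Setoid (CommutativeSemiring.setoid R)
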